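{- Let $q$ be a prime power and let $1 \leq k < n$ be integers. If the statement $A(n,k)$ holds with constant $0 < C_{n,k} \leq 1$, then the statement $B(n,k)$ holds with constant $$D_{n,k} = \frac{k}{n} \cdot \log_q\left(\frac{1}{C_{n,k}}\right).$$
   Context: $\mathbb{F}_q$ is the finite field with $q$ elements ($q$ is fixed), and linear means $\mathbb{F}_q$-linear. For integers $1 \leq k < n$ and $m \geq 1$, a subset $S \subseteq \mathbb{F}_q^n$ is $(k,m)$-Furstenberg if for each $k$-dimensional linear subspace $W$ of $\mathbb{F}_q^n$ there is a translate of $W$ that intersects $S$ in at least $m$ points. For a random variable $R$ taking values in $\mathbb{F}_q^N$, its $q$-ary min-entropy is $\mathbf{H}^q_\infty(R) = -\log_q\left(\max_{w \in \mathbb{F}_q^N} \Pr[R = w]\right)$. Statement $A(n,k)$ holds with constant $C_{n,k}$ if: for every $m$ and every $S \subseteq \mathbb{F}_q^n$ that is $(k,m)$-Furstenberg, $|S| \geq C_{n,k} \cdot m^{n/k}$. Statement $B(n,k)$ holds with constant $D_{n,k}$ if: for all $\delta \in [0,1]$, if $S \subseteq \mathbb{F}_q^n$ has size $|S| = q^{\delta n}$, then there exists an onto linear map $\varphi : \mathbb{F}_q^n \to \mathbb{F}_q^{n-k}$ such that $\mathbf{H}^q_\infty(\varphi(U_S)) \geq \delta(n-k) - D_{n,k}$, where $U_S$ is a random variable distributed uniformly over $S$. -}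

module Defs where

open import Algebra.Bundles using (CommutativeRing)
open import Algebra.Module.Bundles.Raw using (RawModule; module RawModule)
open import Algebra.Module.Morphism.Structures using (module ModuleMorphisms)
open import Algebra.Structures using (IsCommutativeRing)
open import Data.Bool.Base using (Bool; T; _∧_; if_then_else_)
open import Data.Empty using (⊥; ⊥-elim)
open import Data.Fin.Base using (Fin; zero; suc)
import Data.Fin.Properties as Fin
open import Data.Integer.Base as ℤ using (ℤ; _⊖_; -[1+_]) renaming (+_ to pos)
import Data.Integer.Properties as ℤ
open import Data.Integer.Solver using () renaming (module +-*-Solver to ℤSolver)
open import Data.List.Base as List using (List; []; _∷_)
open import Data.List.Membership.Propositional using (_∈_)
open import Data.List.Membership.Propositional.Properties using (∈-map⁺; ∈-allFin; ∈-cartesianProductWith⁺)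
open import Data.List.Relation.Unary.Any using (here; there)
open import Data.Nat.Base as ℕ using (ℕ; zero; suc)
open import Data.Nat.Primality using (Prime)
import Data.Nat.Properties as ℕ
open import Data.Product.Base using (∃; ∃₂; _×_; _,_; proj₁; proj₂)
open import Data.Rational.Base as ℚ
  using (ℚ; mkℚ; 0ℚ; 1ℚ; ½; _+_; _*_; _-_; -_; _<_; _≤_; _/_; _⊔_; _⊓_; 1/_; *<*; *≤*;
         Positive; positive; nonNegative; toℚᵘ)
import Data.Rational.Properties as ℚ
open import Data.Rational.Solver using (module +-*-Solver)
open import Data.Rational.Unnormalised.Base as ℚᵘ using (mkℚᵘ)
import Data.Rational.Unnormalised.Properties as ℚᵘ
open import Data.Sum.Base using (_⊎_; inj₁; inj₂)
open import Data.Vec.Base as Vec using (Vec; []; _∷_)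
import Data.Vec.Functional as Vector
import Data.Vec.Properties as Vec
open import Function.Base using (_∘_; _$_; case_of_)
open import Function.Bundles using (_↔_; module Inverse)
open import Function.Definitions using (Surjective)
open import Level using (0ℓ)
open import Relation.Binary.Definitions using (DecidableEquality; tri<; tri≈; tri>)
open import Relation.Binary.PropositionalEquality
  using (_≡_; _≢_; refl; sym; trans; cong; cong₂; subst; subst₂)
open import Relation.Nullary using (yes; no)
open import Relation.Nullary.Decidable using (does; map′)
open import Algebra.Properties.CommutativeSemiring.Exp
  (CommutativeRing.commutativeSemiring ℚ.+-*-commutativeRing)
  using (_^_; ^-homo-*; ^-assocʳ; ^-distrib-*)

fromℕ : ℕ → ℚ
fromℕ n = pos n / 1

module RationalLemmas where

  opaque

    toℚᵘ-/ : ∀ i d → toℚᵘ (i / suc d) ℚᵘ.≃ mkℚᵘ i d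
    toℚᵘ-/ i d = ℚ.toℚᵘ-fromℚᵘ (mkℚᵘ i d)

    fromℕ-suc : ∀ n → fromℕ (suc n) ≡ 1ℚ + fromℕ n
    fromℕ-suc n = ℚ.toℚᵘ-injective $ ℚᵘ.≃-trans (toℚᵘ-/ (pos (suc n)) 0) $ ℚᵘ.≃-sym $
      ℚᵘ.≃-trans (ℚ.toℚᵘ-homo-+ 1ℚ (fromℕ n)) $
      ℚᵘ.≃-trans (ℚᵘ.+-congʳ (toℚᵘ 1ℚ) (toℚᵘ-/ (pos n) 0)) $
      ℚᵘ.*≡* (cong (λ z → (pos 1 ℤ.+ z) ℤ.* pos 1) (ℤ.*-identityʳ (pos n)))

    frac-<⁺ : ∀ i d j e → i ℤ.* pos (suc e) ℤ.< j ℤ.* pos (suc d) → i / suc d < j / suc e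
    frac-<⁺ i d j e p = ℚ.toℚᵘ-cancel-< $
      ℚᵘ.<-respˡ-≃ (ℚᵘ.≃-sym (toℚᵘ-/ i d)) $ ℚᵘ.<-respʳ-≃ (ℚᵘ.≃-sym (toℚᵘ-/ j e)) $ ℚᵘ.*<* p

    frac-<⁻ : ∀ i d j e → i / suc d < j / suc e → i ℤ.* pos (suc e) ℤ.< j ℤ.* pos (suc d)
    frac-<⁻ i d j e p = ℚᵘ.drop-*<* $
      ℚᵘ.<-respˡ-≃ (toℚᵘ-/ i d) $ ℚᵘ.<-respʳ-≃ (toℚᵘ-/ j e) $ ℚ.toℚᵘ-mono-< p

    +-pos : ∀ {a b} → 0ℚ < a → 0ℚ < b → 0ℚ < a + b
    +-pos {a} {b} p q = subst (_< a + b) (ℚ.+-identityʳ 0ℚ) (ℚ.+-mono-< p q)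

    0≤1 : 0ℚ ≤ 1ℚ
    0≤1 = *≤* (ℤ.+≤+ ℕ.z≤n)
    0<1 : 0ℚ < 1ℚ
    0<1 = *<* (ℤ.+<+ (ℕ.s≤s ℕ.z≤n))

    *-monoˡ : ∀ {a b c} → 0ℚ ≤ c → a ≤ b → c * a ≤ c * b
    *-monoˡ {c = c} p = ℚ.*-monoˡ-≤-nonNeg c {{nonNegative p}}
    *-monoʳ : ∀ {a b c} → 0ℚ ≤ c → a ≤ b → a * c ≤ b * c
    *-monoʳ {c = c} p = ℚ.*-monoʳ-≤-nonNeg c {{nonNegative p}}
    *-antiʳ : ∀ {a b c} → c ≤ 0ℚ → a ≤ b → b * c ≤ a * c
    *-antiʳ {c = c} p = ℚ.*-monoʳ-≤-nonPos c {{ℚ.nonPositive p}}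
    *-mono : ∀ {a b c d} → 0ℚ ≤ a → 0ℚ ≤ d → a ≤ b → c ≤ d → a * c ≤ b * d
    *-mono pa pd ab cd = ℚ.≤-trans (*-monoˡ pa cd) (*-monoʳ pd ab)
    *-monoˡ-< : ∀ {a b c} → 0ℚ < c → a < b → c * a < c * b
    *-monoˡ-< {c = c} p = ℚ.*-monoʳ-<-pos c {{positive p}}
    *-monoʳ-< : ∀ {a b c} → 0ℚ < c → a < b → a * c < b * c
    *-monoʳ-< {c = c} p = ℚ.*-monoˡ-<-pos c {{positive p}}
    *-cancelʳ : ∀ {a b c} → 0ℚ < c → a * c ≤ b * c → a ≤ b
    *-cancelʳ {c = c} p = ℚ.*-cancelʳ-≤-pos c {{positive p}}
    *-cancelˡ : ∀ {a b c} → 0ℚ < c → c * a ≤ c * b → a ≤ b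
    *-cancelˡ {c = c} p = ℚ.*-cancelˡ-≤-pos c {{positive p}}
    *-nonNeg : ∀ {a b} → 0ℚ ≤ a → 0ℚ ≤ b → 0ℚ ≤ a * b
    *-nonNeg {a} {b} p q = subst (_≤ a * b) (ℚ.*-zeroʳ a) (*-monoˡ p q)
    *-pos : ∀ {a b} → 0ℚ < a → 0ℚ < b → 0ℚ < a * b
    *-pos {a} {b} p q = subst (_< a * b) (ℚ.*-zeroʳ a) (*-monoˡ-< p q)

    recip : ∀ {a} → 0ℚ < a → ∃ λ b → 0ℚ < b × b * a ≡ 1ℚ
    recip {a} p = 1/ a , ℚ.positive⁻¹ (1/ a) {{ℚ.1/pos⇒pos a}} , ℚ.*-inverseˡ a
      where instance
        _ : Positive a
        _ = positive p
        _ : ℚ.NonZero a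
        _ = ℚ.pos⇒nonZero a

    0<½ : 0ℚ < ½
    0<½ = *<* (ℤ.+<+ (ℕ.s≤s ℕ.z≤n))

    half : ∀ a → ½ * a + ½ * a ≡ a
    half a = trans (sym (ℚ.*-distribʳ-+ a ½ ½)) (ℚ.*-identityˡ a)

    half-pos : ∀ {a} → 0ℚ < a → 0ℚ < ½ * a
    half-pos = *-pos 0<½

    between : ∀ {p q} → p < q → ∃ λ m → p < m × m < q
    between = ℚ.<-dense

    p<p+ε : ∀ {p ε} → 0ℚ < ε → p < p + ε
    p<p+ε {p} {ε} 0<ε = subst (_< p + ε) (ℚ.+-identityʳ p) (ℚ.+-monoʳ-< p 0<ε)

    p≤p+ε : ∀ {p ε} → 0ℚ ≤ ε → p ≤ p + ε
    p≤p+ε {p} {ε} 0<ε = subst (_≤ p + ε) (ℚ.+-identityʳ p) (ℚ.+-monoʳ-≤ p 0<ε)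

    p-ε<p : ∀ {p ε} → 0ℚ < ε → p - ε < p
    p-ε<p {p} {ε} 0<ε = subst (p - ε <_) (ℚ.+-identityʳ p) (ℚ.+-monoʳ-< p (ℚ.neg-antimono-< 0<ε))

    0<q-p : ∀ {p q} → p < q → 0ℚ < q - p
    0<q-p {p} {q} p<q = subst (_< q - p) (ℚ.+-inverseʳ p) (ℚ.+-monoˡ-< (- p) p<q)

    p+[q-p] : ∀ p q → p + (q - p) ≡ q
    p+[q-p] = solve 2 (λ p q → p :+ (q :- p) := q) refl where open +-*-Solver

    fromℕ-nonNeg : ∀ n → 0ℚ ≤ fromℕ n
    fromℕ-nonNeg n = ℚ.nonNegative⁻¹ (fromℕ n) {{ℚ.normalize-nonNeg n 1}}

    below-ℕ : ∀ p → ∃ λ n → p ≤ fromℕ n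
    below-ℕ p@(mkℚ (pos n) d _) = n , ℚ.toℚᵘ-cancel-≤ (ℚᵘ.≤-respʳ-≃ (ℚᵘ.≃-sym (toℚᵘ-/ (pos n) 0))
      (ℚᵘ.*≤* (ℤ.*-monoˡ-≤-nonNeg (pos n) (ℤ.+≤+ (ℕ.s≤s ℕ.z≤n)))))
    below-ℕ p@(mkℚ -[1+ n ] d _) = 0 , ℚ.<⇒≤ (ℚ.negative⁻¹ p)

    archimedes : ∀ a {h} → 0ℚ < h → ∃ λ n → a ≤ fromℕ n * h
    archimedes a {h} 0<h =
      let b , 0<b , ba = recip 0<h
          n , q = below-ℕ (a * b)
      in n , subst (_≤ fromℕ n * h) (trans (ℚ.*-assoc a b h) (trans (cong (a *_) ba) (ℚ.*-identityʳ a)))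
            (*-monoʳ (ℚ.<⇒≤ 0<h) q)

    ^-pos : ∀ {a} n → 0ℚ < a → 0ℚ < a ^ n
    ^-pos zero    p = 0<1
    ^-pos (suc n) p = *-pos p (^-pos n p)

    ^-mono : ∀ {a b} n → 0ℚ < a → a ≤ b → a ^ n ≤ b ^ n
    ^-mono zero    p q = ℚ.≤-refl
    ^-mono (suc n) p q = *-mono (ℚ.<⇒≤ p) (ℚ.<⇒≤ (^-pos n (ℚ.<-≤-trans p q))) q (^-mono n p q)

    ^-mono-< : ∀ {a b} n → 0ℚ < a → a < b → a ^ suc n < b ^ suc n
    ^-mono-< {a} {b} n p q = ℚ.<-≤-trans (*-monoʳ-< (^-pos n p) q)
      (*-monoˡ (ℚ.<⇒≤ (ℚ.<-trans p q)) (^-mono n p (ℚ.<⇒≤ q)))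

    1≤^ : ∀ {a} n → 1ℚ ≤ a → 1ℚ ≤ a ^ n
    1≤^ zero    p = ℚ.≤-refl
    1≤^ {a} (suc n) p = *-mono {1ℚ} {a} {1ℚ} {a ^ n} 0≤1 (ℚ.≤-trans 0≤1 (1≤^ n p)) p (1≤^ n p)

    ^-monoʳ : ∀ {a m n} → 1ℚ ≤ a → m ℕ.≤ n → a ^ m ≤ a ^ n
    ^-monoʳ {n = n} p ℕ.z≤n       = 1≤^ n p
    ^-monoʳ p (ℕ.s≤s m≤n) = *-monoˡ (ℚ.≤-trans 0≤1 p) (^-monoʳ p m≤n)

    a≤a^ : ∀ {a} n → 1ℚ ≤ a → a ≤ a ^ suc n
    a≤a^ {a} n p = subst (_≤ a ^ suc n) (ℚ.*-identityʳ a) (*-monoˡ (ℚ.≤-trans 0≤1 p) (1≤^ n p))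

    ^≤1 : ∀ {a} n → 0ℚ < a → a ≤ 1ℚ → a ^ n ≤ 1ℚ
    ^≤1 zero    p q = ℚ.≤-refl
    ^≤1 {a} (suc n) p q = *-mono {a} {1ℚ} {a ^ n} {1ℚ} (ℚ.<⇒≤ p) 0≤1 q (^≤1 n p q)

    a^≤a : ∀ {a} n → 0ℚ < a → a ≤ 1ℚ → a ^ suc n ≤ a
    a^≤a {a} n p q = subst (a ^ suc n ≤_) (ℚ.*-identityʳ a) (*-monoˡ (ℚ.<⇒≤ p) (^≤1 n p q))

    bernoulli : ∀ {h} n → 0ℚ ≤ h → fromℕ n * h ≤ (1ℚ + h) ^ n
    bernoulli {h} n p = ℚ.≤-trans (ℚ.≤-trans (p≤p+ε 0≤1) (ℚ.≤-reflexive (ℚ.+-comm (fromℕ n * h) 1ℚ))) (go n)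
      where
      go : ∀ n → 1ℚ + fromℕ n * h ≤ (1ℚ + h) ^ n
      go zero    = ℚ.≤-reflexive (trans (cong (1ℚ +_) (ℚ.*-zeroˡ h)) (ℚ.+-identityʳ 1ℚ))
      go (suc n) = ℚ.≤-trans
        (ℚ.≤-trans (p≤p+ε (*-nonNeg (*-nonNeg (fromℕ-nonNeg n) p) p)) (ℚ.≤-reflexive eq))
        (*-monoˡ (ℚ.≤-trans 0≤1 (p≤p+ε p)) (go n))
        where
        open +-*-Solver
        eq : (1ℚ + fromℕ (suc n) * h) + (fromℕ n * h) * h ≡ (1ℚ + h) * (1ℚ + fromℕ n * h)
        eq rewrite fromℕ-suc n = solve 2
          (λ c h → (con 1ℚ :+ (con 1ℚ :+ c) :* h) :+ (c :* h) :* h := (con 1ℚ :+ h) :* (con 1ℚ :+ c :* h))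
          refl (fromℕ n) h

    unbounded : ∀ {a} b → 1ℚ < a → ∃ λ n → b ≤ a ^ n
    unbounded {a} b p =
      let n , q = archimedes b {a - 1ℚ} (0<q-p {1ℚ} {a} p) in
      n , ℚ.≤-trans q (subst (λ z → fromℕ n * (a - 1ℚ) ≤ z ^ n) (p+[q-p] 1ℚ a) (bernoulli {a - 1ℚ} n (ℚ.<⇒≤ {0ℚ} {a - 1ℚ} (0<q-p {1ℚ} {a} p))))

    square-below : ∀ {c} → 1ℚ < c → ∃ λ d → 1ℚ < d × d * d ≤ c
    square-below {c} p = d , 1<d , dd
      where
      g t u d : ℚ
      g = (c - 1ℚ) ⊓ 1ℚ
      t = ½ * g
      u = ½ * t
      d = 1ℚ + u
      0<g : 0ℚ < g
      0<g with ℚ.≤-total (c - 1ℚ) 1ℚ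
      ... | inj₁ q = subst (0ℚ <_) (sym (ℚ.p≤q⇒p⊓q≡p q)) (0<q-p p)
      ... | inj₂ q = subst (0ℚ <_) (sym (ℚ.p≥q⇒p⊓q≡q q)) 0<1
      0≤t : 0ℚ ≤ t
      0≤t = ℚ.<⇒≤ (half-pos 0<g)
      0<u : 0ℚ < u
      0<u = half-pos (half-pos 0<g)
      1<d : 1ℚ < d
      1<d = p<p+ε 0<u
      u≤t : u ≤ t
      u≤t = subst (u ≤_) (half t) (p≤p+ε (ℚ.<⇒≤ 0<u))
      t≤g : t ≤ g
      t≤g = subst (t ≤_) (half g) (p≤p+ε 0≤t)
      u≤1 : u ≤ 1ℚ
      u≤1 = ℚ.≤-trans u≤t (ℚ.≤-trans t≤g (ℚ.p⊓q≤q (c - 1ℚ) 1ℚ))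
      uu≤t : u * u ≤ t
      uu≤t = ℚ.≤-trans (subst (u * u ≤_) (ℚ.*-identityʳ u) (*-monoˡ (ℚ.<⇒≤ 0<u) u≤1)) u≤t
      bound : (u + u) + u * u ≤ c - 1ℚ
      bound = ℚ.≤-trans (subst (λ z → (u + u) + u * u ≤ z) (trans (cong (_+ t) (half t)) (half g))
        (ℚ.+-monoʳ-≤ (u + u) uu≤t)) (ℚ.p⊓q≤p (c - 1ℚ) 1ℚ)
      square : ∀ v → 1ℚ + ((v + v) + v * v) ≡ (1ℚ + v) * (1ℚ + v)
      square = solve 1 (λ v → con 1ℚ :+ ((v :+ v) :+ v :* v) := (con 1ℚ :+ v) :* (con 1ℚ :+ v)) refl
        where open +-*-Solver
      dd : d * d ≤ c
      dd = subst₂ _≤_ (square u) (p+[q-p] 1ℚ c) (ℚ.+-monoʳ-≤ 1ℚ bound)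

    small-base : ∀ {c} n → 1ℚ < c → ∃ λ l → 1ℚ < l × l ^ n ≤ c
    small-base {c} zero    p = c , p , ℚ.<⇒≤ p
    small-base {c} (suc n) p =
      let d , 1<d , dd = square-below p
          l , 1<l , q = small-base n 1<d
      in case ℚ.≤-total l d of λ where
        (inj₁ l≤d) → l , 1<l , ℚ.≤-trans
          (*-mono (ℚ.≤-trans 0≤1 (ℚ.<⇒≤ 1<l)) (ℚ.≤-trans 0≤1 (ℚ.<⇒≤ 1<d)) l≤d q) dd
        (inj₂ d≤l) → d , 1<d , ℚ.≤-trans
          (*-monoˡ (ℚ.≤-trans 0≤1 (ℚ.<⇒≤ 1<d)) (ℚ.≤-trans (^-mono n (ℚ.<-trans 0<1 1<d) d≤l) q)) dd

open RationalLemmas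

-- Dedekind real numbers: located two-sided cuts of ℚ.
record ℝ : Set₁ where
  no-eta-equality
  field
    L U         : ℚ → Set
    L-inhabited : ∃ L
    U-inhabited : ∃ U
    L-lower     : ∀ {p q} → p < q → L q → L p
    U-upper     : ∀ {p q} → p < q → U p → U q
    L-open      : ∀ {p} → L p → ∃ λ q → p < q × L q
    U-open      : ∀ {q} → U q → ∃ λ p → p < q × U p
    disjoint    : ∀ {p} → L p → U p → ⊥
    located     : ∀ {p q} → p < q → L p ⊎ U q

  L<U : ∀ {p q} → L p → U q → p < q
  L<U {p} {q} Lp Uq with ℚ.<-cmp p q
  ... | tri< p<q _ _  = p<q
  ... | tri≈ _ refl _ = ⊥-elim (disjoint Lp Uq)
  ... | tri> _ _ q<p  = ⊥-elim (disjoint (L-lower q<p Lp) Uq)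

open ℝ

infix 4 _<ℝ_ _≤ℝ_ _≈ℝ_

record _<ℝ_ (x y : ℝ) : Set where
  constructor <-witness
  field
    {cut} : ℚ
    below : U x cut
    above : L y cut

record _≤ℝ_ (x y : ℝ) : Set where
  constructor L-mono
  field
    L-⊆ : ∀ {p} → L x p → L y p

open _≤ℝ_

_≈ℝ_ : ℝ → ℝ → Set
x ≈ℝ y = x ≤ℝ y × y ≤ℝ x

-- The real number whose rational lower bounds include A and whose rational
-- upper bounds include B, when these determine it.
between-bounds : (A B : ℚ → Set) → ∃ A → ∃ B →
  (∀ {a b} → A a → B b → a ≤ b) →
  (∀ {p q} → p < q → (∃ λ a → p ≤ a × A a) ⊎ (∃ λ b → b ≤ q × B b)) →
  ℝ
between-bounds A B inhA inhB A≤B gap .L p = ∃ λ a → p < a × A a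
between-bounds A B inhA inhB A≤B gap .U q = ∃ λ b → b < q × B b
between-bounds A B inhA inhB A≤B gap .L-inhabited =
    let a , Aa = inhA in a - 1ℚ , a , p-ε<p 0<1 , Aa
between-bounds A B inhA inhB A≤B gap .U-inhabited =
    let b , Bb = inhB in b + 1ℚ , b , p<p+ε 0<1 , Bb
between-bounds A B inhA inhB A≤B gap .L-lower p<q (a , q<a , Aa) = a , ℚ.<-trans p<q q<a , Aa
between-bounds A B inhA inhB A≤B gap .U-upper p<q (b , b<p , Bb) = b , ℚ.<-trans b<p p<q , Bb
between-bounds A B inhA inhB A≤B gap .L-open (a , p<a , Aa) =
    let m , p<m , m<a = between p<a in m , p<m , a , m<a , Aa
between-bounds A B inhA inhB A≤B gap .U-open (b , b<q , Bb) =
    let m , b<m , m<q = between b<q in m , m<q , b , b<m , Bb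
between-bounds A B inhA inhB A≤B gap .disjoint (a , p<a , Aa) (b , b<p , Bb) =
    ℚ.<-irrefl refl (ℚ.<-≤-trans (ℚ.<-trans b<p p<a) (A≤B Aa Bb))
between-bounds A B inhA inhB A≤B gap .located p<q =
    let m , p<m , m<q = between p<q
        n , m<n , n<q = between m<q
    in case gap m<n of λ where
         (inj₁ (a , m≤a , Aa)) → inj₁ (a , ℚ.<-≤-trans p<m m≤a , Aa)
         (inj₂ (b , b≤n , Bb)) → inj₂ (b , ℚ.≤-<-trans b≤n n<q , Bb)

-- Arbitrarily close bounds suffice.
Close : (A B : ℚ → Set) → Set
Close A B = ∀ {ε} → 0ℚ < ε → ∃₂ λ a b → A a × B b × b ≤ a + ε

opaque

  close⇒inhabitedˡ : ∀ {A B} → Close A B → ∃ A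
  close⇒inhabitedˡ close = let a , _ , Aa , _ = close 0<1 in a , Aa

  close⇒inhabitedʳ : ∀ {A B} → Close A B → ∃ B
  close⇒inhabitedʳ close = let _ , b , _ , Bb , _ = close 0<1 in b , Bb

  close⇒gap : ∀ {A B} → Close A B → ∀ {p q} → p < q → (∃ λ a → p ≤ a × A a) ⊎ (∃ λ b → b ≤ q × B b)
  close⇒gap close {p} {q} p<q =
    let a , b , Aa , Bb , b≤a+ε = close (0<q-p p<q) in
    case ℚ.≤-total p a of λ where
      (inj₁ p≤a) → inj₁ (a , p≤a , Aa)
      (inj₂ a≤p) → inj₂ (b , subst (b ≤_) (p+[q-p] p q)
                               (ℚ.≤-trans b≤a+ε (ℚ.+-monoˡ-≤ (q - p) a≤p)) , Bb)

  approx : ∀ x {ε} → 0ℚ < ε → ∃₂ λ l u → L x l × U x u × u ≤ l + ε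
  approx x {ε} 0<ε =
    let l₀ , Ll₀ = L-inhabited x
        u₀ , Uu₀ = U-inhabited x
        n , u₀-l₀≤ = archimedes (u₀ - l₀) (half-pos 0<ε)
    in search n Ll₀ Uu₀ (subst (_≤ l₀ + fromℕ n * η) (p+[q-p] l₀ u₀) (ℚ.+-monoʳ-≤ l₀ u₀-l₀≤))
    where
    η : ℚ
    η = ½ * ε
    step : ∀ n l → l + fromℕ (suc n) * η ≡ (l + η) + fromℕ n * η
    step n l rewrite fromℕ-suc n =
      solve 3 (λ l c η → l :+ (con 1ℚ :+ c) :* η := (l :+ η) :+ c :* η) refl l (fromℕ n) η
      where open +-*-Solver
    search : ∀ n {l u₀} → L x l → U x u₀ → u₀ ≤ l + fromℕ n * η → ∃₂ λ l u → L x l × U x u × u ≤ l + ε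
    search zero {l} {u₀} Ll Uu₀ u₀≤l = ⊥-elim (ℚ.<-irrefl refl (ℚ.<-≤-trans (L<U x Ll Uu₀)
      (subst (u₀ ≤_) (trans (cong (l +_) (ℚ.*-zeroˡ η)) (ℚ.+-identityʳ l)) u₀≤l)))
    search (suc n) {l} {u₀} Ll Uu₀ u₀≤ =
      case located x (p<p+ε {l + η} (half-pos 0<ε)) of λ where
        (inj₁ L′) → search n L′ Uu₀ (subst (u₀ ≤_) (step n l) u₀≤)
        (inj₂ U′) → l , _ , Ll , U′ ,
          ℚ.≤-reflexive (trans (ℚ.+-assoc l η η) (cong (l +_) (half ε)))

from-bounds : (A B : ℚ → Set) → (∀ {a b} → A a → B b → a ≤ b) → Close A B → ℝ
from-bounds A B A≤B close =
  between-bounds A B (close⇒inhabitedˡ close) (close⇒inhabitedʳ close) A≤B (close⇒gap close)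

opaque

  singleton-≤ : ∀ {c a b} → a ≡ c → b ≡ c → a ≤ b
  singleton-≤ refl refl = ℚ.≤-refl

  singleton-close : ∀ c → Close (_≡ c) (_≡ c)
  singleton-close c 0<ε = c , c , refl , refl , p≤p+ε (ℚ.<⇒≤ 0<ε)

fromℚ : ℚ → ℝ
fromℚ c = from-bounds (_≡ c) (_≡ c) singleton-≤ (singleton-close c)

0ℝ 1ℝ : ℝ
0ℝ = fromℚ 0ℚ
1ℝ = fromℚ 1ℚ

infixl 6 _+ℝ_ _-ℝ_
infixl 7 _*ℝ_
infix  8 -ℝ_

Sum : (A B : ℚ → Set) → ℚ → Set
Sum A B c = ∃₂ λ a b → A a × B b × c ≡ a + b

opaque

  Sum-≤ : ∀ x y {c c′} → Sum (L x) (L y) c → Sum (U x) (U y) c′ → c ≤ c′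
  Sum-≤ x y (a , b , La , Lb , refl) (a′ , b′ , Ua , Ub , refl) =
    ℚ.<⇒≤ (ℚ.+-mono-< (L<U x La Ua) (L<U y Lb Ub))

  Sum-close : ∀ x y → Close (Sum (L x) (L y)) (Sum (U x) (U y))
  Sum-close x y {ε} 0<ε =
    let a , a′ , La , Ua , p = approx x (half-pos 0<ε)
        b , b′ , Lb , Ub , q = approx y (half-pos 0<ε)
    in a + b , a′ + b′ , (a , b , La , Lb , refl) , (a′ , b′ , Ua , Ub , refl) ,
       subst (a′ + b′ ≤_) (trans (shuffle a b (½ * ε)) (cong (a + b +_) (half ε))) (ℚ.+-mono-≤ p q)
    where
    open +-*-Solver
    shuffle : ∀ a b c → (a + c) + (b + c) ≡ (a + b) + (c + c)
    shuffle = solve 3 (λ a b c → (a :+ c) :+ (b :+ c) := (a :+ b) :+ (c :+ c)) refl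

_+ℝ_ : ℝ → ℝ → ℝ
x +ℝ y = from-bounds (Sum (L x) (L y)) (Sum (U x) (U y)) (Sum-≤ x y) (Sum-close x y)

Negative : (A : ℚ → Set) → ℚ → Set
Negative A c = ∃ λ a → A a × c ≡ - a

opaque

  Negative-≤ : ∀ x {c c′} → Negative (U x) c → Negative (L x) c′ → c ≤ c′
  Negative-≤ x (u , Uu , refl) (l , Ll , refl) = ℚ.<⇒≤ (ℚ.neg-antimono-< (L<U x Ll Uu))

  Negative-close : ∀ x → Close (Negative (U x)) (Negative (L x))
  Negative-close x {ε} 0<ε =
    let l , u , Ll , Uu , p = approx x 0<ε
    in - u , - l , (u , Uu , refl) , (l , Ll , refl) ,
       subst₂ _≤_ (left l u) (right ε l u) (ℚ.+-monoˡ-≤ (- l - u) p)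
    where
    open +-*-Solver
    left : ∀ l u → u + (- l - u) ≡ - l
    left = solve 2 (λ l u → u :+ (:- l :- u) := :- l) refl
    right : ∀ ε l u → (l + ε) + (- l - u) ≡ - u + ε
    right = solve 3 (λ ε l u → (l :+ ε) :+ (:- l :- u) := :- u :+ ε) refl

-ℝ_ : ℝ → ℝ
-ℝ x = from-bounds (Negative (U x)) (Negative (L x)) (Negative-≤ x) (Negative-close x)

_-ℝ_ : ℝ → ℝ → ℝ
x -ℝ y = x +ℝ (-ℝ y)

-- v is at most (at least) all four products of endpoints of [a , b] and [c , d].
_≤corners[_,_]×[_,_] _≥corners[_,_]×[_,_] : (v a b c d : ℚ) → Set
v ≤corners[ a , b ]×[ c , d ] = (v ≤ a * c × v ≤ a * d) × (v ≤ b * c × v ≤ b * d)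
v ≥corners[ a , b ]×[ c , d ] = (a * c ≤ v × a * d ≤ v) × (b * c ≤ v × b * d ≤ v)

ProductLower ProductUpper : (x y : ℝ) → ℚ → Set
ProductLower x y v = ∃₂ λ a b → ∃₂ λ c d → (L x a × U x b) × (L y c × U y d) × v ≤corners[ a , b ]×[ c , d ]
ProductUpper x y v = ∃₂ λ a b → ∃₂ λ c d → (L x a × U x b) × (L y c × U y d) × v ≥corners[ a , b ]×[ c , d ]

opaque

  ≤edge : ∀ {v a b z} c → a ≤ z → z ≤ b → v ≤ a * c → v ≤ b * c → v ≤ z * c
  ≤edge c a≤z z≤b p q = case ℚ.≤-total 0ℚ c of λ where
    (inj₁ 0≤c) → ℚ.≤-trans p (*-monoʳ 0≤c a≤z)
    (inj₂ c≤0) → ℚ.≤-trans q (*-antiʳ c≤0 z≤b)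

  ≥edge : ∀ {v a b z} c → a ≤ z → z ≤ b → a * c ≤ v → b * c ≤ v → z * c ≤ v
  ≥edge c a≤z z≤b p q = case ℚ.≤-total 0ℚ c of λ where
    (inj₁ 0≤c) → ℚ.≤-trans (*-monoʳ 0≤c z≤b) q
    (inj₂ c≤0) → ℚ.≤-trans (*-antiʳ c≤0 a≤z) p

  ≤corners⇒≤ : ∀ {v a b c d} z w → a ≤ z → z ≤ b → c ≤ w → w ≤ d →
               v ≤corners[ a , b ]×[ c , d ] → v ≤ z * w
  ≤corners⇒≤ {v} {a} {b} {c} {d} z w a≤z z≤b c≤w w≤d ((ac , ad) , (bc , bd)) =
    subst (v ≤_) (ℚ.*-comm w z) (≤edge z c≤w w≤d
      (subst (v ≤_) (ℚ.*-comm z c) (≤edge c a≤z z≤b ac bc))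
      (subst (v ≤_) (ℚ.*-comm z d) (≤edge d a≤z z≤b ad bd)))

  ≥corners⇒≥ : ∀ {v a b c d} z w → a ≤ z → z ≤ b → c ≤ w → w ≤ d →
               v ≥corners[ a , b ]×[ c , d ] → z * w ≤ v
  ≥corners⇒≥ {v} {a} {b} {c} {d} z w a≤z z≤b c≤w w≤d ((ac , ad) , (bc , bd)) =
    subst (_≤ v) (ℚ.*-comm w z) (≥edge z c≤w w≤d
      (subst (_≤ v) (ℚ.*-comm z c) (≥edge c a≤z z≤b ac bc))
      (subst (_≤ v) (ℚ.*-comm z d) (≥edge d a≤z z≤b ad bd)))

  L-max : ∀ x {p q} → L x p → L x q → L x (p ⊔ q)
  L-max x {p} {q} Lp Lq = case ℚ.≤-total p q of λ where
    (inj₁ p≤q) → subst (L x) (sym (ℚ.p≤q⇒p⊔q≡q p≤q)) Lq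
    (inj₂ q≤p) → subst (L x) (sym (ℚ.p≥q⇒p⊔q≡p q≤p)) Lp

  U-min : ∀ x {p q} → U x p → U x q → U x (p ⊓ q)
  U-min x {p} {q} Up Uq = case ℚ.≤-total p q of λ where
    (inj₁ p≤q) → subst (U x) (sym (ℚ.p≤q⇒p⊓q≡p p≤q)) Up
    (inj₂ q≤p) → subst (U x) (sym (ℚ.p≥q⇒p⊓q≡q q≤p)) Uq

  bound : ℝ → ℚ
  bound x = 1ℚ + (ℚ.∣ proj₁ (L-inhabited x) ∣ + ℚ.∣ proj₁ (U-inhabited x) ∣)

  p≤∣p∣ : ∀ p → p ≤ ℚ.∣ p ∣
  p≤∣p∣ p = case ℚ.≤-total 0ℚ p of λ where
    (inj₁ 0≤p) → ℚ.≤-reflexive (sym (ℚ.0≤p⇒∣p∣≡p 0≤p))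
    (inj₂ p≤0) → ℚ.≤-trans p≤0 (ℚ.0≤∣p∣ p)

  0<bound : ∀ x → 0ℚ < bound x
  0<bound x = ℚ.<-≤-trans 0<1 (p≤p+ε (ℚ.≤-trans (ℚ.0≤∣p∣ (proj₁ (L-inhabited x)))
    (p≤p+ε (ℚ.0≤∣p∣ (proj₁ (U-inhabited x))))))

  approx-bounded : ∀ x {ε} → 0ℚ < ε → ∃₂ λ l u → (L x l × U x u) × u ≤ l + ε ×
                   (- bound x ≤ l × u ≤ bound x)
  approx-bounded x {ε} 0<ε =
    let l₀ , Ll₀ = L-inhabited x
        u₀ , Uu₀ = U-inhabited x
        l , u , Ll , Uu , p = approx x 0<ε
    in l ⊔ l₀ , u ⊓ u₀ , (L-max x Ll Ll₀ , U-min x Uu Uu₀) ,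
       ℚ.≤-trans (ℚ.p⊓q≤p u u₀) (ℚ.≤-trans p (ℚ.+-monoˡ-≤ ε (ℚ.p≤p⊔q l l₀))) ,
       (ℚ.≤-trans (lower l₀ u₀) (ℚ.p≤q⊔p l l₀) , ℚ.≤-trans (ℚ.p⊓q≤q u u₀) (upper l₀ u₀))
    where
    upper : ∀ l u → u ≤ 1ℚ + (ℚ.∣ l ∣ + ℚ.∣ u ∣)
    upper l u = ℚ.≤-trans (p≤∣p∣ u) (ℚ.≤-trans
      (subst (ℚ.∣ u ∣ ≤_) (ℚ.+-comm ℚ.∣ u ∣ ℚ.∣ l ∣) (p≤p+ε (ℚ.0≤∣p∣ l)))
      (subst (ℚ.∣ l ∣ + ℚ.∣ u ∣ ≤_) (ℚ.+-comm (ℚ.∣ l ∣ + ℚ.∣ u ∣) 1ℚ) (p≤p+ε 0≤1)))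
    lower : ∀ l u → - (1ℚ + (ℚ.∣ l ∣ + ℚ.∣ u ∣)) ≤ l
    lower l u = subst (- (1ℚ + (ℚ.∣ l ∣ + ℚ.∣ u ∣)) ≤_) (neg-neg l) (ℚ.neg-antimono-≤
      (ℚ.≤-trans (subst (- l ≤_) (ℚ.∣-p∣≡∣p∣ l) (p≤∣p∣ (- l))) (ℚ.≤-trans (p≤p+ε (ℚ.0≤∣p∣ u))
        (subst (ℚ.∣ l ∣ + ℚ.∣ u ∣ ≤_) (ℚ.+-comm (ℚ.∣ l ∣ + ℚ.∣ u ∣) 1ℚ) (p≤p+ε 0≤1)))))
      where
      neg-neg : ∀ l → - (- l) ≡ l
      neg-neg = solve 1 (λ l → :- (:- l) := l) refl where open +-*-Solver

  small-product : ∀ {K θ η} a h → - K ≤ a → a ≤ K → 0ℚ ≤ K → 0ℚ ≤ h → h ≤ η → K * η ≡ θ →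
                  - θ ≤ a * h × a * h ≤ θ
  small-product {K} {θ} {η} a h -K≤a a≤K 0≤K 0≤h h≤η refl =
    ℚ.≤-trans (ℚ.neg-antimono-≤ Kh≤θ) (subst (_≤ a * h) (sym (ℚ.neg-distribˡ-* K h)) (*-monoʳ 0≤h -K≤a)) ,
    ℚ.≤-trans (*-monoʳ 0≤h a≤K) Kh≤θ
    where
    Kh≤θ : K * h ≤ K * η
    Kh≤θ = *-monoˡ 0≤K h≤η

  box-corners : ∀ {θ} {a b c d} → let t₁ = a * (d - c) ; t₂ = c * (b - a) ; t₃ = b * (d - c) in
    0ℚ ≤ θ → - θ ≤ t₁ × t₁ ≤ θ → - θ ≤ t₂ × t₂ ≤ θ → - θ ≤ t₃ × t₃ ≤ θ →
    (a * c - (θ + θ)) ≤corners[ a , b ]×[ c , d ] × (a * c + (θ + θ)) ≥corners[ a , b ]×[ c , d ]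
  box-corners {θ} {a} {b} {c} {d} 0≤θ h₁ h₂ h₃ =
    ((proj₁ ac , proj₁ ad) , (proj₁ bc , proj₁ bd)) , ((proj₂ ac , proj₂ ad) , (proj₂ bc , proj₂ bd))
    where
    open +-*-Solver
    Near : ℚ → Set
    Near v = (a * c - (θ + θ)) ≤ v × v ≤ a * c + (θ + θ)
    -0≡0 : - 0ℚ ≡ 0ℚ
    -0≡0 = refl
    h₀ : - θ ≤ 0ℚ × 0ℚ ≤ θ
    h₀ = subst (- θ ≤_) -0≡0 (ℚ.neg-antimono-≤ 0≤θ) , 0≤θ
    near : ∀ {v} s t → - θ ≤ s × s ≤ θ → - θ ≤ t × t ≤ θ → a * c + (s + t) ≡ v → Near v
    near s t (-θ≤s , s≤θ) (-θ≤t , t≤θ) refl =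
      subst (λ z → a * c + z ≤ a * c + (s + t)) (sym (ℚ.neg-distrib-+ θ θ)) (ℚ.+-monoʳ-≤ (a * c) (ℚ.+-mono-≤ -θ≤s -θ≤t)) ,
      ℚ.+-monoʳ-≤ (a * c) (ℚ.+-mono-≤ s≤θ t≤θ)
    ac : Near (a * c)
    ac = near 0ℚ 0ℚ h₀ h₀ (ℚ.+-identityʳ (a * c))
    ad : Near (a * d)
    ad = near (a * (d - c)) 0ℚ h₁ h₀
      (solve 3 (λ a c d → a :* c :+ (a :* (d :- c) :+ con 0ℚ) := a :* d) refl a c d)
    bc : Near (b * c)
    bc = near (c * (b - a)) 0ℚ h₂ h₀
      (solve 3 (λ a b c → a :* c :+ (c :* (b :- a) :+ con 0ℚ) := b :* c) refl a b c)
    bd : Near (b * d)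
    bd = near (c * (b - a)) (b * (d - c)) h₂ h₃
      (solve 4 (λ a b c d → a :* c :+ (c :* (b :- a) :+ b :* (d :- c)) := b :* d) refl a b c d)

  Product-≤ : ∀ x y {v w} → ProductLower x y v → ProductUpper x y w → v ≤ w
  Product-≤ x y (a , b , c , d , (La , Ub) , (Lc , Ud) , v≤) (a′ , b′ , c′ , d′ , (La′ , Ub′) , (Lc′ , Ud′) , ≤w) =
    let z = a ⊔ a′
        w = c ⊔ c′
        Lz = L-max x La La′
        Lw = L-max y Lc Lc′
    in ℚ.≤-trans
         (≤corners⇒≤ z w (ℚ.p≤p⊔q a a′) (ℚ.<⇒≤ (L<U x Lz Ub)) (ℚ.p≤p⊔q c c′) (ℚ.<⇒≤ (L<U y Lw Ud)) v≤)
         (≥corners⇒≥ z w (ℚ.p≤q⊔p a a′) (ℚ.<⇒≤ (L<U x Lz Ub′)) (ℚ.p≤q⊔p c c′) (ℚ.<⇒≤ (L<U y Lw Ud′)) ≤w)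

  Product-close : ∀ x y → Close (ProductLower x y) (ProductUpper x y)
  Product-close x y {ε} 0<ε =
    let θ = ½ * (½ * ε)
        0<θ = half-pos (half-pos 0<ε)
        r , 0<r , rK≡1 = recip 0<K
        η = r * θ
        Kη≡θ : K * η ≡ θ
        Kη≡θ = trans (sym (ℚ.*-assoc K r θ)) (trans (cong (_* θ) (trans (ℚ.*-comm K r) rK≡1)) (ℚ.*-identityˡ θ))
        a , b , (La , Ub) , b≤ , ab = approx-bounded x (*-pos 0<r 0<θ)
        c , d , (Lc , Ud) , d≤ , cd = approx-bounded y (*-pos 0<r 0<θ)
        a≤b = ℚ.<⇒≤ (L<U x La Ub)
        c≤d = ℚ.<⇒≤ (L<U y Lc Ud)
        0≤K = ℚ.<⇒≤ 0<K
        -K≤a , a≤K = in-K a boundx≤K ab ℚ.≤-refl a≤b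
        -K≤b , b≤K = in-K b boundx≤K ab a≤b ℚ.≤-refl
        -K≤c , c≤K = in-K c boundy≤K cd ℚ.≤-refl c≤d
        lo , hi = box-corners {θ} {a} {b} {c} {d} (ℚ.<⇒≤ 0<θ)
          (small-product a (d - c) -K≤a a≤K 0≤K (0≤- c≤d) (minus d≤) Kη≡θ)
          (small-product c (b - a) -K≤c c≤K 0≤K (0≤- a≤b) (minus b≤) Kη≡θ)
          (small-product b (d - c) -K≤b b≤K 0≤K (0≤- c≤d) (minus d≤) Kη≡θ)
    in a * c - (θ + θ) , a * c + (θ + θ) ,
       (a , b , c , d , (La , Ub) , (Lc , Ud) , lo) ,
       (a , b , c , d , (La , Ub) , (Lc , Ud) , hi) ,
       ℚ.≤-reflexive (width (a * c) ε)
    where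
    K : ℚ
    K = bound x + bound y
    0<K : 0ℚ < K
    0<K = +-pos (0<bound x) (0<bound y)
    boundx≤K : bound x ≤ K
    boundx≤K = p≤p+ε (ℚ.<⇒≤ (0<bound y))
    boundy≤K : bound y ≤ K
    boundy≤K = subst (bound y ≤_) (ℚ.+-comm (bound y) (bound x)) (p≤p+ε (ℚ.<⇒≤ (0<bound x)))
    minus : ∀ {l u η} → u ≤ l + η → u - l ≤ η
    minus {l} {u} {η} p = subst (u - l ≤_) (cancel l η) (ℚ.+-monoˡ-≤ (- l) p)
      where
      cancel : ∀ l η → (l + η) - l ≡ η
      cancel = solve 2 (λ l η → (l :+ η) :- l := η) refl where open +-*-Solver
    in-K : ∀ {k l u} z → k ≤ K → - k ≤ l × u ≤ k → l ≤ z → z ≤ u → - K ≤ z × z ≤ K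
    in-K z k≤K (-k≤l , u≤k) l≤z z≤u =
      ℚ.≤-trans (ℚ.neg-antimono-≤ k≤K) (ℚ.≤-trans -k≤l l≤z) , ℚ.≤-trans z≤u (ℚ.≤-trans u≤k k≤K)
    0≤- : ∀ {p q} → p ≤ q → 0ℚ ≤ q - p
    0≤- {p} {q} p≤q = subst (_≤ q - p) (ℚ.+-inverseʳ p) (ℚ.+-monoˡ-≤ (- p) p≤q)
    regroup : ∀ p h → p + h ≡ (p - h) + (h + h)
    regroup = solve 2 (λ p h → p :+ h := (p :- h) :+ (h :+ h)) refl where open +-*-Solver
    width : ∀ p ε → p + (½ * (½ * ε) + ½ * (½ * ε)) ≡ (p - (½ * (½ * ε) + ½ * (½ * ε))) + ε
    width p ε = trans (regroup p _) (cong (p - (½ * (½ * ε) + ½ * (½ * ε)) +_)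
      (trans (cong₂ _+_ (half (½ * ε)) (half (½ * ε))) (half ε)))

_*ℝ_ : ℝ → ℝ → ℝ
x *ℝ y = from-bounds (ProductLower x y) (ProductUpper x y) (Product-≤ x y) (Product-close x y)

Either Both : (A B : ℚ → Set) → ℚ → Set
Either A B p = A p ⊎ B p
Both   A B p = A p × B p

opaque

  Max-inhabitedˡ : ∀ x y → ∃ (Either (L x) (L y))
  Max-inhabitedˡ x y = let l , Ll = L-inhabited x in l , inj₁ Ll

  Max-inhabitedʳ : ∀ x y → ∃ (Both (U x) (U y))
  Max-inhabitedʳ x y =
    let u , Uu = U-inhabited x
        v , Uv = U-inhabited y
    in u ⊔ v , U-≤ x (ℚ.p≤p⊔q u v) Uu , U-≤ y (ℚ.p≤q⊔p u v) Uv
    where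
    U-≤ : ∀ z {p q} → p ≤ q → U z p → U z q
    U-≤ z {p} {q} p≤q Up with ℚ.<-cmp p q
    ... | tri< p<q _ _  = U-upper z p<q Up
    ... | tri≈ _ refl _ = Up
    ... | tri> _ _ q<p  = ⊥-elim (ℚ.<-irrefl refl (ℚ.<-≤-trans q<p p≤q))

  Max-≤ : ∀ x y {a b} → Either (L x) (L y) a → Both (U x) (U y) b → a ≤ b
  Max-≤ x y (inj₁ La) (Ub , _) = ℚ.<⇒≤ (L<U x La Ub)
  Max-≤ x y (inj₂ La) (_ , Ub) = ℚ.<⇒≤ (L<U y La Ub)

  Max-gap : ∀ x y {p q} → p < q → (∃ λ a → p ≤ a × Either (L x) (L y) a) ⊎ (∃ λ b → b ≤ q × Both (U x) (U y) b)
  Max-gap x y {p} {q} p<q = case (located x p<q , located y p<q) of λ where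
    (inj₁ Lp , _)       → inj₁ (p , ℚ.≤-refl , inj₁ Lp)
    (_       , inj₁ Lp) → inj₁ (p , ℚ.≤-refl , inj₂ Lp)
    (inj₂ Uq , inj₂ Vq) → inj₂ (q , ℚ.≤-refl , Uq , Vq)

infixl 6 _⊔ℝ_
_⊔ℝ_ : ℝ → ℝ → ℝ
x ⊔ℝ y = between-bounds (Either (L x) (L y)) (Both (U x) (U y))
  (Max-inhabitedˡ x y) (Max-inhabitedʳ x y) (Max-≤ x y) (Max-gap x y)

ReciprocalLower ReciprocalUpper : ℝ → ℚ → Set
ReciprocalLower x v = ∃ λ u → U x u × v * u ≤ 1ℚ
ReciprocalUpper x v = ∃ λ l → L x l × 0ℚ < l × 1ℚ ≤ v * l

opaque

  ≤ℝ-refl : ∀ {x} → x ≤ℝ x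
  ≤ℝ-refl = L-mono λ Lp → Lp

  ≤ℝ-trans : ∀ {x y z} → x ≤ℝ y → y ≤ℝ z → x ≤ℝ z
  ≤ℝ-trans x≤y y≤z = L-mono λ Lp → L-⊆ y≤z (L-⊆ x≤y Lp)

  positive-ℝ : ∀ {x p} → 0ℚ < p → L x p → 0ℝ <ℝ x
  positive-ℝ 0<p Lp = <-witness (0ℚ , 0<p , refl) Lp

  pos-lower : ∀ {x} → 0ℝ <ℝ x → ∃ λ l → 0ℚ < l × L x l
  pos-lower (<-witness {l} (_ , 0<l , refl) Ll) = l , 0<l , Ll

  Reciprocal-inhabitedˡ : ∀ x → ∃ (ReciprocalLower x)
  Reciprocal-inhabitedˡ x =
    let u , Uu = U-inhabited x in 0ℚ , u , Uu , subst (_≤ 1ℚ) (sym (ℚ.*-zeroˡ u)) 0≤1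

  Reciprocal-inhabitedʳ : ∀ x → 0ℝ <ℝ x → ∃ (ReciprocalUpper x)
  Reciprocal-inhabitedʳ x 0<x =
    let l , 0<l , Ll = pos-lower 0<x
        r , _ , rl≡1 = recip 0<l
    in r , l , Ll , 0<l , ℚ.≤-reflexive (sym rl≡1)

  Reciprocal-≤ : ∀ x {v w} → ReciprocalLower x v → ReciprocalUpper x w → v ≤ w
  Reciprocal-≤ x {v} {w} (u , Uu , vu≤1) (l , Ll , 0<l , 1≤wl) = case ℚ.≤-total v w of λ where
      (inj₁ v≤w) → v≤w
      (inj₂ w≤v) → *-cancelʳ 0<l (ℚ.≤-trans (*-monoˡ (0≤v w≤v) (ℚ.<⇒≤ (L<U x Ll Uu))) (ℚ.≤-trans vu≤1 1≤wl))
    where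
    0≤w : 0ℚ ≤ w
    0≤w = *-cancelʳ 0<l (subst (_≤ w * l) (sym (ℚ.*-zeroˡ l)) (ℚ.≤-trans 0≤1 1≤wl))
    0≤v : w ≤ v → 0ℚ ≤ v
    0≤v = ℚ.≤-trans 0≤w
  Reciprocal-gap : ∀ x {p q} → p < q → (∃ λ a → p ≤ a × ReciprocalLower x a) ⊎
                                     (∃ λ b → b ≤ q × ReciprocalUpper x b)
  Reciprocal-gap x {p} {q} p<q with ℚ.<-cmp 0ℚ p
  ... | tri< 0<p _ _ =
    let r , 0<r , rp≡1 = recip 0<p
        s , 0<s , sq≡1 = recip (ℚ.<-trans 0<p p<q)
        s<r : s < r
        s<r = ℚ.≰⇒> λ r≤s → ℚ.<-irrefl (trans rp≡1 (sym sq≡1))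
          (ℚ.≤-<-trans (*-monoʳ (ℚ.<⇒≤ 0<p) r≤s) (*-monoˡ-< 0<s p<q))
    in case located x s<r of λ where
      (inj₁ Ls) → inj₂ (q , ℚ.≤-refl , s , Ls , 0<s , ℚ.≤-reflexive (trans (sym sq≡1) (ℚ.*-comm s q)))
      (inj₂ Ur) → inj₁ (p , ℚ.≤-refl , r , Ur , ℚ.≤-reflexive (trans (ℚ.*-comm p r) rp≡1))
  ... | tri≈ _ 0≡p _ = inj₁ (0ℚ , ℚ.≤-reflexive (sym 0≡p) , _ , proj₂ (U-inhabited x) ,
                             subst (_≤ 1ℚ) (sym (ℚ.*-zeroˡ (proj₁ (U-inhabited x)))) 0≤1)
  ... | tri> _ _ p<0 = inj₁ (0ℚ , ℚ.<⇒≤ p<0 , _ , proj₂ (U-inhabited x) ,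
                             subst (_≤ 1ℚ) (sym (ℚ.*-zeroˡ (proj₁ (U-inhabited x)))) 0≤1)

inv : (x : ℝ) → 0ℝ <ℝ x → ℝ
inv x 0<x = between-bounds (ReciprocalLower x) (ReciprocalUpper x)
  (Reciprocal-inhabitedˡ x) (Reciprocal-inhabitedʳ x 0<x) (Reciprocal-≤ x) (Reciprocal-gap x)

opaque

  inv-pos : ∀ {x} (0<x : 0ℝ <ℝ x) → 0ℝ <ℝ inv x 0<x
  inv-pos {x} 0<x =
    let l , 0<l , Ll = pos-lower 0<x
        u , Uu = U-inhabited x
        r , 0<r , ru≡1 = recip (ℚ.<-trans 0<l (L<U x Ll Uu))
        m , 0<m , m<r = between 0<r
    in positive-ℝ 0<m (r , m<r , u , Uu , ℚ.≤-reflexive ru≡1)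

-- PowAtMost b e s and PowAtLeast b e s say that b ^ e ≤ s and b ^ e ≥ s, for rational e
-- and positive rational s: with e = (m - n) / (d + 1), the inequality is raised to the
-- power d + 1 and multiplied by b ^ n.
PowAtMost PowAtLeast : ℕ → ℚ → ℚ → Set
PowAtMost  b e s = ∃₂ λ m n → ∃ λ d → e ≡ (m ⊖ n) / suc d × fromℕ b ^ m ≤ s ^ suc d * fromℕ b ^ n
PowAtLeast b e s = ∃₂ λ m n → ∃ λ d → e ≡ (m ⊖ n) / suc d × s ^ suc d * fromℕ b ^ n ≤ fromℕ b ^ m

module PowerLemmas where

  opaque

    1≤base : ∀ b → .{{ℕ.NonZero b}} → 1ℚ ≤ fromℕ b
    1≤base (suc b) = ℚ.≤-trans (p≤p+ε (fromℕ-nonNeg b)) (ℚ.≤-reflexive (sym (fromℕ-suc b)))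

    1<base : ∀ b → 1 ℕ.< b → 1ℚ < fromℕ b
    1<base (suc zero) (ℕ.s≤s ())
    1<base (suc (suc b)) _ = ℚ.<-≤-trans (p<p+ε {1ℚ} {fromℕ (suc b)} (ℚ.<-≤-trans 0<1 (1≤base (suc b))))
      (ℚ.≤-reflexive (sym (fromℕ-suc (suc b))))

    cross-< : ∀ m n d m′ n′ d′ → (m ⊖ n) / suc d < (m′ ⊖ n′) / suc d′ →
              m ℕ.* suc d′ ℕ.+ n′ ℕ.* suc d ℕ.< m′ ℕ.* suc d ℕ.+ n ℕ.* suc d′
    cross-< m n d m′ n′ d′ p = ℤ.drop‿+<+ (subst₂ ℤ._<_ (eq m n (suc d′) n′ (suc d))
      (trans (cong (λ z → (m′ ⊖ n′) ℤ.* pos (suc d) ℤ.+ z) (ℤ.+-comm (pos (n ℕ.* suc d′)) (pos (n′ ℕ.* suc d))))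
             (eq m′ n′ (suc d) n (suc d′)))
      (ℤ.+-monoˡ-< (pos (n ℕ.* suc d′) ℤ.+ pos (n′ ℕ.* suc d)) (frac-<⁻ (m ⊖ n) d (m′ ⊖ n′) d′ p)))
      where
      open ℤSolver
      eqℤ : ∀ m n d n′ d′ → (m ℤ.- n) ℤ.* d ℤ.+ (n ℤ.* d ℤ.+ n′ ℤ.* d′) ≡ m ℤ.* d ℤ.+ n′ ℤ.* d′
      eqℤ = solve 5 (λ m n d n′ d′ → (m :- n) :* d :+ (n :* d :+ n′ :* d′) := m :* d :+ n′ :* d′) refl
      eq : ∀ m n d n′ d′ → (m ⊖ n) ℤ.* pos d ℤ.+ (pos (n ℕ.* d) ℤ.+ pos (n′ ℕ.* d′)) ≡ pos (m ℕ.* d ℕ.+ n′ ℕ.* d′)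
      eq m n d n′ d′ = trans
        (cong₂ ℤ._+_ (cong (ℤ._* pos d) (sym (ℤ.m-n≡m⊖n m n))) (cong₂ ℤ._+_ (ℤ.pos-* n d) (ℤ.pos-* n′ d′)))
        (trans (eqℤ (pos m) (pos n) (pos d) (pos n′) (pos d′))
               (sym (cong₂ ℤ._+_ (ℤ.pos-* m d) (ℤ.pos-* n′ d′))))

    ^-raise : ∀ s d β n d′ → (s ^ d * β ^ n) ^ d′ ≡ s ^ (d ℕ.* d′) * β ^ (n ℕ.* d′)
    ^-raise s d β n d′ = trans (^-distrib-* (s ^ d) (β ^ n) d′) (cong₂ _*_ (^-assocʳ s d d′) (^-assocʳ β n d′))

    pow-order : ∀ {b e e′ s s′} → .{{ℕ.NonZero b}} → 0ℚ < s → 0ℚ < s′ → e < e′ →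
                PowAtLeast b e s → PowAtMost b e′ s′ → s ≤ s′
    pow-order {b} {s = s} {s′} 0<s 0<s′ e<e′ (m , n , d , refl , s≤) (m′ , n′ , d′ , refl , ≤s′) =
      case ℚ.≤-total s s′ of λ where
        (inj₁ s≤s′) → s≤s′
        (inj₂ s′≤s) → case ℚ.<-cmp s′ s of λ where
          (tri< s′<s _ _) → ⊥-elim (ℚ.<-irrefl refl (ℚ.<-≤-trans (^-mono-< (d′ ℕ.+ d ℕ.* D′) 0<s′ s′<s) s^≤s′^))
          (tri≈ _ eq _)   → ℚ.≤-reflexive (sym eq)
          (tri> _ _ s<s′) → ℚ.<⇒≤ s<s′
      where
      D D′ : ℕ
      D = suc d
      D′ = suc d′
      β : ℚ
      β = fromℕ b
      1≤β : 1ℚ ≤ β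
      1≤β = 1≤base b
      0<β : 0ℚ < β
      0<β = ℚ.<-≤-trans 0<1 1≤β
      S S′ P Q P′ Q′ : ℚ
      S  = s ^ (D ℕ.* D′)
      S′ = s′ ^ (D ℕ.* D′)
      P  = β ^ (m ℕ.* D′)
      Q  = β ^ (n ℕ.* D′)
      P′ = β ^ (m′ ℕ.* D)
      Q′ = β ^ (n′ ℕ.* D)
      SQ≤P : S * Q ≤ P
      SQ≤P = subst₂ _≤_ (^-raise s D β n D′) (^-assocʳ β m D′)
        (^-mono D′ (*-pos (^-pos D 0<s) (^-pos n 0<β)) s≤)
      P′≤S′Q′ : P′ ≤ S′ * Q′
      P′≤S′Q′ = subst₂ _≤_ (^-assocʳ β m′ D)
        (trans (^-raise s′ D′ β n′ D) (cong (λ k → s′ ^ k * Q′) (ℕ.*-comm D′ D)))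
        (^-mono D (^-pos m′ 0<β) ≤s′)
      PQ′≤P′Q : P * Q′ ≤ P′ * Q
      PQ′≤P′Q = subst₂ _≤_ (^-homo-* β (m ℕ.* D′) (n′ ℕ.* D)) (^-homo-* β (m′ ℕ.* D) (n ℕ.* D′))
        (^-monoʳ 1≤β (ℕ.<⇒≤ (cross-< m n d m′ n′ d′ e<e′)))
      0<Q : 0ℚ < Q
      0<Q = ^-pos (n ℕ.* D′) 0<β
      0<Q′ : 0ℚ < Q′
      0<Q′ = ^-pos (n′ ℕ.* D) 0<β
      rearrange : ∀ s q q′ → s * (q * q′) ≡ (s * q) * q′
      rearrange s q q′ = sym (ℚ.*-assoc s q q′)
      rearrange′ : ∀ s q q′ → (s * q′) * q ≡ s * (q * q′)
      rearrange′ = solve 3 (λ s q q′ → (s :* q′) :* q := s :* (q :* q′)) refl where open +-*-Solver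
      s^≤s′^ : S ≤ S′
      s^≤s′^ = *-cancelʳ (*-pos 0<Q 0<Q′)
        (subst₂ _≤_ (sym (rearrange S Q Q′)) (rearrange′ S′ Q Q′)
          (ℚ.≤-trans (*-monoʳ (ℚ.<⇒≤ 0<Q′) SQ≤P) (ℚ.≤-trans PQ′≤P′Q (*-monoʳ (ℚ.<⇒≤ 0<Q) P′≤S′Q′))))

    -- a lower and an upper bound for the (d + 1)-st root of y, within a factor c
    root-bounds : ∀ d {y c} → 0ℚ < y → 1ℚ < c →
                  ∃₂ λ s t → 0ℚ < s × s < t × y ≤ s ^ suc d × t ^ suc d ≤ c * y
    root-bounds d {y} {c} 0<y 1<c =
      let λ₁ , 1<λ₁ , λ₁^≤c = small-base (suc d ℕ.+ suc d) 1<c in from-step λ₁ 1<λ₁ λ₁^≤c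
      where
      from-step : ∀ λ₁ → 1ℚ < λ₁ → λ₁ ^ (suc d ℕ.+ suc d) ≤ c →
        ∃₂ λ s t → 0ℚ < s × s < t × y ≤ s ^ suc d × t ^ suc d ≤ c * y
      from-step λ₁ 1<λ₁ λ₁^≤c =
        search (proj₁ start) 0<u₀ u₀^≤y (ℚ.≤-trans y≤[1+y]^ (^-mono {1ℚ + y} {λ₁ ^ proj₁ start * u₀} D (+-pos 0<1 0<y) (proj₂ start)))
        where
        D : ℕ
        D = suc d
        0<λ₁ : 0ℚ < λ₁
        0<λ₁ = ℚ.<-trans 0<1 1<λ₁
        Λ : ℚ
        Λ = λ₁ ^ D
        1≤Λ : 1ℚ ≤ Λ
        1≤Λ = 1≤^ D (ℚ.<⇒≤ 1<λ₁)
        0≤Λ : 0ℚ ≤ Λ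
        0≤Λ = ℚ.≤-trans 0≤1 1≤Λ
        ΛΛ≤c : Λ * Λ ≤ c
        ΛΛ≤c = subst (_≤ c) (^-homo-* λ₁ D D) λ₁^≤c
        Λ≤c : Λ ≤ c
        Λ≤c = ℚ.≤-trans (subst (_≤ Λ * Λ) (ℚ.*-identityʳ Λ) (*-monoˡ 0≤Λ 1≤Λ)) ΛΛ≤c
        u₀ : ℚ
        u₀ = y ⊓ 1ℚ
        0<u₀ : 0ℚ < u₀
        0<u₀ = case ℚ.≤-total y 1ℚ of λ where
          (inj₁ q) → subst (0ℚ <_) (sym (ℚ.p≤q⇒p⊓q≡p q)) 0<y
          (inj₂ q) → subst (0ℚ <_) (sym (ℚ.p≥q⇒p⊓q≡q q)) 0<1
        u₀^≤y : u₀ ^ D ≤ y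
        u₀^≤y = ℚ.≤-trans (a^≤a d 0<u₀ (ℚ.p⊓q≤q y 1ℚ)) (ℚ.p⊓q≤p y 1ℚ)
        y≤[1+y]^ : y ≤ (1ℚ + y) ^ D
        y≤[1+y]^ = ℚ.≤-trans (subst (_≤ 1ℚ + y) (ℚ.+-identityˡ y) (ℚ.+-monoˡ-≤ y 0≤1))
          (a≤a^ {1ℚ + y} d (p≤p+ε {1ℚ} {y} (ℚ.<⇒≤ 0<y)))
        start : ∃ λ N → 1ℚ + y ≤ λ₁ ^ N * u₀
        start =
          let r , 0<r , ru≡1 = recip 0<u₀
              N , q = unbounded ((1ℚ + y) * r) 1<λ₁
              eq : (1ℚ + y) * r * u₀ ≡ 1ℚ + y
              eq = trans (ℚ.*-assoc (1ℚ + y) r u₀) (trans (cong ((1ℚ + y) *_) ru≡1) (ℚ.*-identityʳ (1ℚ + y)))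
          in N , subst (_≤ λ₁ ^ N * u₀) eq (*-monoʳ {(1ℚ + y) * r} {λ₁ ^ N} {u₀} (ℚ.<⇒≤ 0<u₀) q)
        grow : ∀ {u} → 0ℚ < u → u < λ₁ * u
        grow {u} 0<u = subst (_< λ₁ * u) (ℚ.*-identityˡ u) (*-monoʳ-< 0<u 1<λ₁)
        0≤c : 0ℚ ≤ c
        0≤c = ℚ.≤-trans 0≤1 (ℚ.<⇒≤ 1<c)
        search : ∀ N {u} → 0ℚ < u → u ^ D ≤ y → y ≤ (λ₁ ^ N * u) ^ D →
                 ∃₂ λ s t → 0ℚ < s × s < t × y ≤ s ^ D × t ^ D ≤ c * y
        search zero {u} 0<u u^≤y y≤ = u , λ₁ * u , 0<u , grow 0<u ,
          subst (λ z → y ≤ z ^ D) (ℚ.*-identityˡ u) y≤ ,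
          subst (_≤ c * y) (sym (^-distrib-* λ₁ u D)) (*-mono {Λ} {c} {u ^ D} {y} 0≤Λ (ℚ.<⇒≤ 0<y) Λ≤c u^≤y)
        search (suc N) {u} 0<u u^≤y y≤ = case ℚ.≤-total y ((λ₁ * u) ^ D) of λ where
          (inj₁ y≤′) → λ₁ * u , λ₁ * (λ₁ * u) , *-pos 0<λ₁ 0<u , grow (*-pos 0<λ₁ 0<u) , y≤′ ,
            subst (_≤ c * y)
              (trans (ℚ.*-assoc Λ Λ (u ^ D)) (sym (trans (^-distrib-* λ₁ (λ₁ * u) D) (cong (Λ *_) (^-distrib-* λ₁ u D)))))
              (*-mono {Λ * Λ} {c} {u ^ D} {y} (*-nonNeg {Λ} {Λ} 0≤Λ 0≤Λ) (ℚ.<⇒≤ 0<y) ΛΛ≤c u^≤y)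
          (inj₂ ≤y) → search N (*-pos 0<λ₁ 0<u) ≤y (subst (λ z → y ≤ z ^ D)
            (trans (cong (_* u) (ℚ.*-comm λ₁ (λ₁ ^ N))) (ℚ.*-assoc (λ₁ ^ N) λ₁ u)) y≤)

    shift-⊖ : ∀ k m n → (k ℕ.+ m) ⊖ (k ℕ.+ n) ≡ m ⊖ n
    shift-⊖ zero    m n = refl
    shift-⊖ (suc k) m n = trans (ℤ.[1+m]⊖[1+n]≡m⊖n (k ℕ.+ m) (k ℕ.+ n)) (shift-⊖ k m n)

    as-⊖ : ∀ i → ∃₂ λ m n → i ≡ m ⊖ n
    as-⊖ (pos n)  = n , 0 , refl
    as-⊖ -[1+ n ] = 0 , suc n , refl

    common : ∀ {i j} → i ℤ.< j → ∃ λ n → ∃₂ λ m m′ → i ≡ m ⊖ n × j ≡ m′ ⊖ n × m ℕ.< m′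
    common {i} {j} i<j =
      let a , a′ , i≡ = as-⊖ i
          c , c′ , j≡ = as-⊖ j
          i≡′ : i ≡ (c′ ℕ.+ a) ⊖ (c′ ℕ.+ a′)
          i≡′ = trans i≡ (sym (shift-⊖ c′ a a′))
          j≡′ : j ≡ (a′ ℕ.+ c) ⊖ (c′ ℕ.+ a′)
          j≡′ = trans j≡ (trans (sym (shift-⊖ a′ c c′)) (cong ((a′ ℕ.+ c) ⊖_) (ℕ.+-comm a′ c′)))
      in c′ ℕ.+ a′ , c′ ℕ.+ a , a′ ℕ.+ c , i≡′ , j≡′ ,
         ℕ.≰⇒> λ le → ℤ.<-irrefl refl (ℤ.<-≤-trans i<j
           (subst₂ ℤ._≤_ (sym j≡′) (sym i≡′) (ℤ.⊖-monoˡ-≤ (c′ ℕ.+ a′) le)))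

    expand : ∀ i d f → i / suc d ≡ (i ℤ.* pos (suc f)) / (suc d ℕ.* suc f)
    expand i d f = ℚ.toℚᵘ-injective (ℚᵘ.≃-trans (toℚᵘ-/ i d) (ℚᵘ.≃-trans
      (ℚᵘ.*≡* (trans (cong (i ℤ.*_) (trans (ℤ.pos-* (suc d) (suc f)) (ℤ.*-comm (pos (suc d)) (pos (suc f)))))
                     (sym (ℤ.*-assoc i (pos (suc f)) (pos (suc d))))))
      (ℚᵘ.≃-sym (toℚᵘ-/ (i ℤ.* pos (suc f)) (f ℕ.+ d ℕ.* suc f)))))

    common-denominator : ∀ {p q} → p < q → ∃₂ λ n d → ∃₂ λ m m′ →
                         p ≡ (m ⊖ n) / suc d × q ≡ (m′ ⊖ n) / suc d × m ℕ.< m′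
    common-denominator {p@(mkℚ i d _)} {q@(mkℚ j f _)} (*<* i<j) =
      let n , m , m′ , i≡ , j≡ , m<m′ = common i<j
      in n , f ℕ.+ d ℕ.* suc f , m , m′ ,
         trans (sym (ℚ.↥p/↧p≡p p)) (trans (expand i d f) (cong (_/ (suc d ℕ.* suc f)) i≡)) ,
         trans (sym (ℚ.↥p/↧p≡p q)) (trans (expand j f d) (trans
           (ℚ./-cong {p₁ = j ℤ.* pos (suc d)} refl (ℕ.*-comm (suc f) (suc d))) (cong (_/ (suc d ℕ.* suc f)) j≡))) ,
         m<m′

open PowerLemmas

LogLower LogUpper : ℕ → ℝ → ℚ → Set
LogLower b x e = ∃ λ s → 0ℚ < s × L x s × PowAtMost  b e s
LogUpper b x e = ∃ λ s → 0ℚ < s × U x s × PowAtLeast b e s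

module Log (b : ℕ) .{{_ : ℕ.NonTrivial b}} (x : ℝ) (0<x : 0ℝ <ℝ x) where
  opaque

    1<b : 1 ℕ.< b
    1<b = ℕ.nonTrivial⇒n>1 b
    β : ℚ
    β = fromℕ b
    1<β : 1ℚ < β
    1<β = 1<base b 1<b
    0<β : 0ℚ < β
    0<β = ℚ.<-trans 0<1 1<β
    0<U : ∀ {u} → U x u → 0ℚ < u
    0<U Uu = let l , 0<l , Ll = pos-lower 0<x in ℚ.<-trans 0<l (L<U x Ll Uu)
    inhabitedˡ : ∃ (LogLower b x)
    inhabitedˡ =
      let l , 0<l , Ll = pos-lower 0<x
          r , 0<r , rl≡1 = recip 0<l
          n , r≤ = unbounded r 1<β
      in (0 ⊖ n) / 1 , l , 0<l , Ll , 0 , n , 0 , refl ,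
         subst₂ _≤_ (trans (ℚ.*-comm l r) rl≡1) (cong (_* β ^ n) (sym (ℚ.*-identityʳ l))) (*-monoˡ (ℚ.<⇒≤ 0<l) r≤)
    inhabitedʳ : ∃ (LogUpper b x)
    inhabitedʳ =
      let u , Uu = U-inhabited x
          m , u≤ = unbounded u 1<β
      in (m ⊖ 0) / 1 , u , 0<U Uu , Uu , m , 0 , 0 , refl ,
         subst (_≤ β ^ m) (trans (sym (ℚ.*-identityʳ u)) (sym (ℚ.*-identityʳ (u * 1ℚ)))) u≤
    separated : ∀ {e e′} → LogLower b x e → LogUpper b x e′ → e ≤ e′
    separated {e} {e′} (s , 0<s , Ls , p) (s′ , 0<s′ , Us′ , p′) = ℚ.≮⇒≥ λ e′<e →
      ℚ.<-irrefl refl (ℚ.<-≤-trans (L<U x Ls Us′)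
        (pow-order {b} {{ℕ.>-nonZero (ℕ.<-trans (ℕ.s≤s ℕ.z≤n) 1<b)}} 0<s′ 0<s e′<e p′ p))
    gap : ∀ {p q} → p < q → (∃ λ e → p ≤ e × LogLower b x e) ⊎ (∃ λ e → e ≤ q × LogUpper b x e)
    gap {p} {q} p<q =
      let n , d , m , m′ , p≡ , q≡ , m<m′ = common-denominator p<q
          r , 0<r , rβ^≡1 = recip (^-pos n 0<β)
          y = β ^ m * r
          y*β^ : y * β ^ n ≡ β ^ m
          y*β^ = trans (ℚ.*-assoc (β ^ m) r (β ^ n)) (trans (cong (β ^ m *_) rβ^≡1) (ℚ.*-identityʳ (β ^ m)))
          s , t , 0<s , s<t , y≤ , ≤βy = root-bounds d (*-pos (^-pos m 0<β) 0<r) 1<β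
          0≤β^n = ℚ.<⇒≤ (^-pos n 0<β)
      in case located x s<t of λ where
        (inj₁ Ls) → inj₁ (p , ℚ.≤-refl , s , 0<s , Ls , m , n , d , p≡ ,
          subst (_≤ s ^ suc d * β ^ n) y*β^ (*-monoʳ 0≤β^n y≤))
        (inj₂ Ut) → inj₂ (q , ℚ.≤-refl , t , ℚ.<-trans 0<s s<t , Ut , m′ , n , d , q≡ ,
          ℚ.≤-trans (subst (t ^ suc d * β ^ n ≤_) (trans (ℚ.*-assoc β y (β ^ n)) (cong (β *_) y*β^)) (*-monoʳ 0≤β^n ≤βy))
                    (^-monoʳ (ℚ.<⇒≤ 1<β) m<m′))

log : (b : ℕ) → .{{ℕ.NonTrivial b}} → (x : ℝ) → 0ℝ <ℝ x → ℝ
log b x 0<x = between-bounds (LogLower b x) (LogUpper b x) inhabitedˡ inhabitedʳ separated gap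
  where open Log b x 0<x

PowLower PowUpper : ℕ → ℝ → ℚ → Set
PowLower b x s = 0ℚ < s × ∃ λ e → L x e × PowAtLeast b e s
PowUpper b x s = 0ℚ < s × ∃ λ e → U x e × PowAtMost  b e s

module Pow (b : ℕ) .{{_ : ℕ.NonZero b}} (x : ℝ) where
  opaque

    β : ℚ
    β = fromℕ b
    1≤β : 1ℚ ≤ β
    1≤β = 1≤base b
    0<β : 0ℚ < β
    0<β = ℚ.<-≤-trans 0<1 1≤β
    as-fraction : ∀ e → ∃₂ λ m n → ∃ λ d → e ≡ (m ⊖ n) / suc d
    as-fraction e@(mkℚ i d _) =
      let m , n , i≡ = as-⊖ i in m , n , d , trans (sym (ℚ.↥p/↧p≡p e)) (cong (_/ suc d) i≡)
    separated : ∀ {s s′} → PowLower b x s → PowUpper b x s′ → s ≤ s′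
    separated (0<s , e , Le , p) (0<s′ , e′ , Ue′ , p′) = pow-order 0<s 0<s′ (L<U x Le Ue′) p p′
    inhabitedˡ : ∃ (PowLower b x)
    inhabitedˡ =
      let e , Le = L-inhabited x
          m , n , d , e≡ = as-fraction e
          s , 0<s , sβ^≡1 = recip (^-pos n 0<β)
          s≤1 : s ≤ 1ℚ
          s≤1 = subst₂ _≤_ (ℚ.*-identityʳ s) sβ^≡1 (*-monoˡ (ℚ.<⇒≤ 0<s) (1≤^ n 1≤β))
      in s , 0<s , e , Le , m , n , d , e≡ ,
         ℚ.≤-trans (*-monoʳ (ℚ.<⇒≤ (^-pos n 0<β)) (a^≤a d 0<s s≤1))
           (ℚ.≤-trans (ℚ.≤-reflexive sβ^≡1) (1≤^ m 1≤β))
    inhabitedʳ : ∃ (PowUpper b x)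
    inhabitedʳ =
      let e , Ue = U-inhabited x
          m , n , d , e≡ = as-fraction e
          s = β ^ m
      in s , ^-pos m 0<β , e , Ue , m , n , d , e≡ ,
         subst (_≤ s ^ suc d * β ^ n) (ℚ.*-identityʳ s)
           (*-mono (ℚ.<⇒≤ (^-pos m 0<β)) (ℚ.<⇒≤ (^-pos n 0<β)) (a≤a^ d (1≤^ m 1≤β)) (1≤^ n 1≤β))
    Gap : ℚ → ℚ → Set
    Gap p q = (∃ λ s → p ≤ s × PowLower b x s) ⊎ (∃ λ s → s ≤ q × PowUpper b x s)
    gap-base-1 : b ≡ 1 → ∀ {p q} → p < q → Gap p q
    gap-base-1 b≡1 {p} {q} p<q = case ℚ.≤-total p 1ℚ of λ where
        (inj₁ p≤1) → let e , Le = L-inhabited x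
                         m , n , d , e≡ = as-fraction e
                     in inj₁ (1ℚ , p≤1 , 0<1 , e , Le , m , n , d , e≡ ,
                              ℚ.≤-reflexive (trans (cong₂ _*_ (1^ (suc d)) (β^ n)) (sym (β^ m))))
        (inj₂ 1≤p) → let e , Ue = U-inhabited x
                         m , n , d , e≡ = as-fraction e
                     in inj₂ (1ℚ , ℚ.≤-trans 1≤p (ℚ.<⇒≤ p<q) , 0<1 , e , Ue , m , n , d , e≡ ,
                              ℚ.≤-reflexive (trans (β^ m) (sym (cong₂ _*_ (1^ (suc d)) (β^ n)))))
      where
      β≡1 : β ≡ 1ℚ
      β≡1 = cong fromℕ b≡1
      1^ : ∀ n → 1ℚ ^ n ≡ 1ℚ
      1^ zero    = refl
      1^ (suc n) = trans (ℚ.*-identityˡ (1ℚ ^ n)) (1^ n)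
      β^ : ∀ n → β ^ n ≡ 1ℚ
      β^ n = trans (cong (_^ n) β≡1) (1^ n)
    gap-pos : 1 ℕ.< b → ∀ {p q} → 0ℚ < p → p < q → Gap p q
    gap-pos 1<b {p} {q} 0<p p<q =
      let r , 0<r , rp≡1 = recip 0<p
          d , ββ≤ = ratio-power r 0<r rp≡1
          D = suc d
          v , 0<v , vp^≡1 = recip (^-pos D 0<p)
          n , v≤ = unbounded v 1<β
          1≤p^β^ : 1ℚ ≤ p ^ D * β ^ n
          1≤p^β^ = subst (_≤ p ^ D * β ^ n) (trans (ℚ.*-comm (p ^ D) v) vp^≡1) (*-monoˡ (ℚ.<⇒≤ (^-pos D 0<p)) v≤)
          N , ≤β^N = unbounded (p ^ D * β ^ n) 1<β
          m , ≤β^m , β^m≤ = least N ≤β^N 1≤p^β^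
          e<e′ : (m ⊖ n) / D < (suc m ⊖ n) / D
          e<e′ = frac-<⁺ (m ⊖ n) d (suc m ⊖ n) d (ℤ.*-monoʳ-<-pos (pos D) (ℤ.⊖-monoˡ-< n (ℕ.n<1+n m)))
      in case located x e<e′ of λ where
        (inj₁ Le) → inj₁ (p , ℚ.≤-refl , 0<p , (m ⊖ n) / D , Le , m , n , d , refl , ≤β^m)
        (inj₂ Ue) → inj₂ (q , ℚ.≤-refl , ℚ.<-trans 0<p p<q , (suc m ⊖ n) / D , Ue , suc m , n , d , refl ,
          ℚ.≤-trans (*-monoˡ (ℚ.<⇒≤ 0<β) β^m≤)
            (subst (_≤ q ^ D * β ^ n) (regroup β (p ^ D) (β ^ n)) (*-monoʳ (ℚ.<⇒≤ (^-pos n 0<β)) ββ≤)))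
      where
      1<β : 1ℚ < β
      1<β = 1<base b 1<b
      regroup : ∀ β p c → (β * β * p) * c ≡ β * (β * (p * c))
      regroup = solve 3 (λ β p c → (β :* β :* p) :* c := β :* (β :* (p :* c))) refl where open +-*-Solver
      ratio-power : ∀ r → 0ℚ < r → r * p ≡ 1ℚ → ∃ λ d → β * β * p ^ suc d ≤ q ^ suc d
      ratio-power r 0<r rp≡1 =
        let k , ββ≤ = unbounded (β * β) 1<rq
        in k , subst (β * β * p ^ suc k ≤_) ([rq]p k)
                 (*-monoʳ (ℚ.<⇒≤ (^-pos (suc k) 0<p)) (ℚ.≤-trans ββ≤ (^-monoʳ (ℚ.<⇒≤ 1<rq) (ℕ.n≤1+n k))))
        where
        1<rq : 1ℚ < r * q
        1<rq = subst (_< r * q) rp≡1 (*-monoˡ-< 0<r p<q)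
        [rq]p : ∀ k → (r * q) ^ suc k * p ^ suc k ≡ q ^ suc k
        [rq]p k = trans (sym (^-distrib-* (r * q) p (suc k))) (cong (_^ suc k)
          (trans (swap r q p) (trans (cong (_* q) rp≡1) (ℚ.*-identityˡ q))))
          where
          swap : ∀ r q p → r * q * p ≡ r * p * q
          swap = solve 3 (λ r q p → r :* q :* p := r :* p :* q) refl where open +-*-Solver
      least : ∀ N {z} → z ≤ β ^ N → 1ℚ ≤ z → ∃ λ m → z ≤ β ^ m × β ^ m ≤ β * z
      least zero {z} z≤ 1≤z = 0 , z≤ , ℚ.≤-trans 1≤z
        (subst (_≤ β * z) (ℚ.*-identityˡ z) (*-monoʳ (ℚ.≤-trans 0≤1 1≤z) 1≤β))
      least (suc N) {z} z≤ 1≤z = case ℚ.≤-total z (β ^ N) of λ where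
        (inj₁ z≤′) → least N z≤′ 1≤z
        (inj₂ ≤z)  → suc N , z≤ , *-monoˡ (ℚ.<⇒≤ 0<β) ≤z
    gap : ∀ {p q} → p < q → (∃ λ s → p ≤ s × PowLower b x s) ⊎ (∃ λ s → s ≤ q × PowUpper b x s)
    gap {p} {q} p<q = case b ℕ.≟ 1 of λ where
      (yes b≡1) → gap-base-1 b≡1 p<q
      (no  b≢1) → case p ℚ.≤? 0ℚ of λ where
        (yes p≤0) → let s , 0<s , R = inhabitedˡ in inj₁ (s , ℚ.≤-trans p≤0 (ℚ.<⇒≤ 0<s) , 0<s , R)
        (no  p≰0) → gap-pos (ℕ.≤∧≢⇒< (ℕ.>-nonZero⁻¹ b) (b≢1 ∘ sym)) (ℚ.≰⇒> p≰0) p<q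

infixr 8 _^ℝ_
_^ℝ_ : (b : ℕ) → .{{ℕ.NonZero b}} → ℝ → ℝ
b ^ℝ x = between-bounds (PowLower b x) (PowUpper b x) inhabitedˡ inhabitedʳ separated gap
  where open Pow b x

opaque

  ^ℝ-pos : ∀ b .{{_ : ℕ.NonZero b}} x → 0ℝ <ℝ b ^ℝ x
  ^ℝ-pos b x =
    let _ , s , _ , 0<s , R = L-inhabited (b ^ℝ x)
        m , 0<m , m<s = between 0<s
    in positive-ℝ 0<m (s , m<s , 0<s , R)

fromℕℝ : ℕ → ℝ
fromℕℝ n = fromℚ (fromℕ n)

Σℝ : ∀ {n} → (Fin n → ℝ) → ℝ
Σℝ = Vector.foldr _+ℝ_ 0ℝ

opaque

  +ℝ-monoʳ : ∀ x {y z} → y ≤ℝ z → x +ℝ y ≤ℝ x +ℝ z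
  +ℝ-monoʳ x y≤z = L-mono λ { (c , p<c , a , b , La , Lb , c≡) → c , p<c , a , b , La , L-⊆ y≤z Lb , c≡ }

  fromℚ-+ : ∀ a b → fromℚ a +ℝ fromℚ b ≈ℝ fromℚ (a + b)
  fromℚ-+ a b =
    L-mono (λ { (c , p<c , a′ , b′ , (_ , a′<a , refl) , (_ , b′<b , refl) , refl) →
         a + b , ℚ.<-trans p<c (ℚ.+-mono-< a′<a b′<b) , refl }) ,
    L-mono (λ { {p} (_ , p<a+b , refl) →
         let c , p<c , c<a+b = between p<a+b
             h = ½ * ((a + b) - c)
             0<h = half-pos (0<q-p c<a+b)
         in c , p<c , a - h , b - h , (a , p-ε<p 0<h , refl) , (b , p-ε<p 0<h , refl) ,
            sym (trans (regroup a b h) (trans (cong (λ z → (a + b) - z) (half ((a + b) - c))) (cancel (a + b) c))) })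
    where
    open +-*-Solver
    regroup : ∀ a b h → (a - h) + (b - h) ≡ (a + b) - (h + h)
    regroup = solve 3 (λ a b h → (a :- h) :+ (b :- h) := (a :+ b) :- (h :+ h)) refl
    cancel : ∀ s c → s - (s - c) ≡ c
    cancel = solve 2 (λ s c → s :- (s :- c) := c) refl

  fromℚ-cong : ∀ {a b} → a ≡ b → fromℚ a ≈ℝ fromℚ b
  fromℚ-cong refl = ≤ℝ-refl , ≤ℝ-refl

  Σℝ-const : ∀ n c → Σℝ {n} (λ _ → fromℚ c) ≈ℝ fromℚ (fromℕ n * c)
  Σℝ-const zero    c = fromℚ-cong {0ℚ} {fromℕ 0 * c} (sym (ℚ.*-zeroˡ c))
  Σℝ-const (suc n) c =
    ≤ℝ-trans {_} {x +ℝ fromℚ r} (+ℝ-monoʳ x (proj₁ IH)) (≤ℝ-trans {_} {fromℚ (c + r)} (proj₁ hom) (proj₁ same)) ,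
    ≤ℝ-trans {_} {fromℚ (c + r)} (proj₂ same) (≤ℝ-trans {_} {x +ℝ fromℚ r} (proj₂ hom) (+ℝ-monoʳ x (proj₂ IH)))
    where
    x : ℝ
    x = fromℚ c
    r : ℚ
    r = fromℕ n * c
    IH : Σℝ {n} (λ _ → fromℚ c) ≈ℝ fromℚ r
    IH = Σℝ-const n c
    hom : x +ℝ fromℚ r ≈ℝ fromℚ (c + r)
    hom = fromℚ-+ c r
    same : fromℚ (c + r) ≈ℝ fromℚ (fromℕ (suc n) * c)
    same = fromℚ-cong {c + r} {fromℕ (suc n) * c} (sym (trans (cong (_* c) (fromℕ-suc n))
      (trans (ℚ.*-distribʳ-+ c 1ℚ (fromℕ n)) (cong (_+ fromℕ n * c) (ℚ.*-identityˡ c)))))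

  n*1/n : ∀ n .{{_ : ℕ.NonZero n}} → fromℕ n * (pos 1 / n) ≡ 1ℚ
  n*1/n (suc n) = ℚ.toℚᵘ-injective
    (ℚᵘ.≃-trans (ℚ.toℚᵘ-homo-* (fromℕ (suc n)) (pos 1 / suc n))
    (ℚᵘ.≃-trans (ℚᵘ.*-cong (toℚᵘ-/ (pos (suc n)) 0) (toℚᵘ-/ (pos 1) n)) (ℚᵘ.*≡* eq)))
    where
    eq : (pos (suc n) ℤ.* pos 1) ℤ.* pos 1 ≡ pos 1 ℤ.* pos (suc (n ℕ.+ 0))
    eq = trans (ℤ.*-identityʳ _) (trans (ℤ.*-identityʳ _)
      (trans (cong (pos ∘ suc) (sym (ℕ.+-identityʳ n))) (sym (ℤ.*-identityˡ _))))

  1/n-nonNeg : ∀ n .{{_ : ℕ.NonZero n}} → 0ℚ ≤ pos 1 / n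
  1/n-nonNeg n = ℚ.nonNegative⁻¹ (pos 1 / n) {{ℚ.normalize-nonNeg 1 n}}

  fromℚ-mono : ∀ {a b} → a ≤ b → fromℚ a ≤ℝ fromℚ b
  fromℚ-mono {b = b} a≤b = L-mono λ { (_ , p<a , refl) → b , ℚ.<-≤-trans p<a a≤b , refl }

  +ℝ-pos⁻ : ∀ {x y} → 0ℝ <ℝ x +ℝ y → 0ℝ <ℝ x ⊎ 0ℝ <ℝ y
  +ℝ-pos⁻ (<-witness (_ , 0<p , refl) (_ , p<c , a , b , La , Lb , refl)) = case a ℚ.≤? 0ℚ of λ where
    (no a≰0)  → inj₁ (positive-ℝ (ℚ.≰⇒> a≰0) La)
    (yes a≤0) → inj₂ (positive-ℝ (ℚ.<-≤-trans (ℚ.<-trans 0<p p<c)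
                  (subst (a + b ≤_) (ℚ.+-identityˡ b) (ℚ.+-monoˡ-≤ b a≤0))) Lb)

  +ℝ-pos⁺ : ∀ {x y} → 0ℝ <ℝ x → 0ℝ ≤ℝ y → 0ℝ <ℝ x +ℝ y
  +ℝ-pos⁺ 0<x 0≤y =
    let l , 0<l , Ll = pos-lower 0<x
        h = ½ * l
        0<h = half-pos 0<l
        m , 0<m , m<h = between 0<h
    in positive-ℝ 0<m (h , m<h , l , - h , Ll ,
         L-⊆ 0≤y (0ℚ , ℚ.neg-antimono-< 0<h , refl) ,
         sym (trans (cong (_- h) (sym (half l))) (cancel h)))
    where
    cancel : ∀ h → h + h - h ≡ h
    cancel = solve 1 (λ h → h :+ h :- h := h) refl where open +-*-Solver

  +ℝ-nonNeg : ∀ {x y} → 0ℝ ≤ℝ x → 0ℝ ≤ℝ y → 0ℝ ≤ℝ x +ℝ y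
  +ℝ-nonNeg 0≤x 0≤y = L-mono λ { (_ , p<0 , refl) →
    let c , p<c , c<0 = between p<0
        h<0 = subst (½ * c <_) (ℚ.*-zeroʳ ½) (*-monoˡ-< 0<½ c<0)
    in c , p<c , ½ * c , ½ * c , L-⊆ 0≤x (0ℚ , h<0 , refl) , L-⊆ 0≤y (0ℚ , h<0 , refl) , sym (half c) }

  Σℝ-nonNeg : ∀ {n} (f : Fin n → ℝ) → (∀ i → 0ℝ ≤ℝ f i) → 0ℝ ≤ℝ Σℝ f
  Σℝ-nonNeg {zero}  f 0≤f = ≤ℝ-refl
  Σℝ-nonNeg {suc n} f 0≤f = +ℝ-nonNeg (0≤f zero) (Σℝ-nonNeg (f ∘ suc) (0≤f ∘ suc))

  Σℝ-pos⁻ : ∀ {n} (f : Fin n → ℝ) → 0ℝ <ℝ Σℝ f → ∃ λ i → 0ℝ <ℝ f i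
  Σℝ-pos⁻ {zero}  f (<-witness (_ , 0<p , refl) (_ , p<0 , refl)) = ⊥-elim (ℚ.<-asym 0<p p<0)
  Σℝ-pos⁻ {suc n} f 0<Σ = case +ℝ-pos⁻ 0<Σ of λ where
    (inj₁ 0<f₀) → zero , 0<f₀
    (inj₂ 0<Σ′) → let i , 0<fᵢ = Σℝ-pos⁻ (f ∘ suc) 0<Σ′ in suc i , 0<fᵢ

  Σℝ-pos⁺ : ∀ {n} (f : Fin n → ℝ) → (∀ i → 0ℝ ≤ℝ f i) → ∀ i → 0ℝ <ℝ f i → 0ℝ <ℝ Σℝ f
  Σℝ-pos⁺ f 0≤f zero 0<f₀ = +ℝ-pos⁺ 0<f₀ (Σℝ-nonNeg (f ∘ suc) (0≤f ∘ suc))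
  Σℝ-pos⁺ f 0≤f (suc i) 0<fᵢ =
    case +ℝ-pos⁺ (Σℝ-pos⁺ (f ∘ suc) (0≤f ∘ suc) i 0<fᵢ) (0≤f zero) of λ where
      (<-witness U0 (c , p<c , a , b , La , Lb , c≡)) →
        <-witness U0 (c , p<c , b , a , Lb , La , trans c≡ (ℚ.+-comm a b))

  ⊔ℝ-posˡ : ∀ {x} y → 0ℝ <ℝ x → 0ℝ <ℝ x ⊔ℝ y
  ⊔ℝ-posˡ {x} y (<-witness U0 Lp) = let q , p<q , Lq = L-open x Lp in <-witness U0 (q , p<q , inj₁ Lq)

  ⊔ℝ-posʳ : ∀ x {y} → 0ℝ <ℝ y → 0ℝ <ℝ x ⊔ℝ y
  ⊔ℝ-posʳ x {y} (<-witness U0 Lp) = let q , p<q , Lq = L-open y Lp in <-witness U0 (q , p<q , inj₂ Lq)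

  power-≉0 : ∀ n b .{{_ : ℕ.NonZero b}} x → fromℕℝ n ≈ℝ (b ^ℝ x) → ℕ.NonZero n
  power-≉0 (suc n) b x _ = _
  power-≉0 zero    b x (_ , b^x≤0) =
    let p , 0<p , Lp = pos-lower (^ℝ-pos b x)
        _ , p<0 , z≡0 = L-⊆ b^x≤0 Lp
    in ⊥-elim (ℚ.<-asym 0<p (subst (p <_) z≡0 p<0))

-- Only applied to nonnegative reals, so that starting from 0 does not affect the maximum.
maxℝ : List ℝ → ℝ
maxℝ = List.foldr _⊔ℝ_ 0ℝ

m<n⇒nonZero : ∀ {m n} → m ℕ.< n → ℕ.NonZero n
m<n⇒nonZero m<n = ℕ.>-nonZero (ℕ.≤-<-trans ℕ.z≤n m<n)

IsPrimePower : ℕ → Set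
IsPrimePower q = ∃₂ λ p e → Prime p × 1 ℕ.≤ e × q ≡ p ℕ.^ e

record FiniteField (q : ℕ) : Set₁ where
  infixl 6 _⊕_
  infixl 7 _⊗_
  field
    Carrier           : Set
    _⊕_ _⊗_           : Carrier → Carrier → Carrier
    neg               : Carrier → Carrier
    0# 1#             : Carrier
    isCommutativeRing : IsCommutativeRing _≡_ _⊕_ _⊗_ neg 0# 1#
    0#≢1#             : 0# ≢ 1#
    inverse           : ∀ a → a ≢ 0# → ∃ λ b → a ⊗ b ≡ 1#
    enumeration       : Fin q ↔ Carrier

  open Inverse enumeration using (to; from; strictlyInverseˡ; strictlyInverseʳ)

  _≟_ : DecidableEquality Carrier
  a ≟ b = map′ (λ eq → trans (sym (strictlyInverseˡ a)) (trans (cong to eq) (strictlyInverseˡ b)))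
               (cong from) (from a Fin.≟ from b)

  elements : List Carrier
  elements = List.map to (List.allFin q)

  ∈-elements : ∀ a → a ∈ elements
  ∈-elements a = subst (_∈ elements) (strictlyInverseˡ a) (∈-map⁺ to (∈-allFin (from a)))

  1<q : 1 ℕ.< q
  1<q = ℕ.≰⇒> λ q≤1 → 0#≢1# (trans (sym (strictlyInverseˡ 0#))
    (trans (cong to (unique q≤1 (from 0#) (from 1#))) (strictlyInverseˡ 1#)))
    where
    unique : ∀ {q} → q ℕ.≤ 1 → (i j : Fin q) → i ≡ j
    unique (ℕ.s≤s ℕ.z≤n) zero zero = refl

-- A random variable on a finite probability space Fin size with real weights.
record RandomVariable (A : Set) : Set₁ where
  field
    size   : ℕ
    weight : Fin size → ℝ
    value  : Fin size → A
    nonNeg : ∀ ω → 0ℝ ≤ℝ weight ω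
    total  : Σℝ weight ≈ℝ 1ℝ

open RandomVariable

_⟨_⟩ : ∀ {A B : Set} → (A → B) → RandomVariable A → RandomVariable B
f ⟨ R ⟩ = record
  { size = size R ; weight = weight R ; value = f ∘ value R ; nonNeg = nonNeg R ; total = total R }

module FurstenbergSets {q : ℕ} (𝔽 : FiniteField q) where
  open FiniteField 𝔽

  instance
    q-nonTrivial : ℕ.NonTrivial q
    q-nonTrivial = ℕ.n>1⇒nonTrivial 1<q

    q-nonZero : ℕ.NonZero q
    q-nonZero = ℕ.>-nonZero (ℕ.<⇒≤ 1<q)

  logq : (x : ℝ) → 0ℝ <ℝ x → ℝ
  logq = log q

  𝔽^ : ℕ → Set
  𝔽^ n = Vec Carrier n

  rawModule : ℕ → RawModule Carrier 0ℓ 0ℓ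
  rawModule n = record
    { Carrierᴹ = 𝔽^ n
    ; _≈ᴹ_     = _≡_
    ; _+ᴹ_     = Vec.zipWith _⊕_
    ; _*ₗ_     = λ a → Vec.map (a ⊗_)
    ; _*ᵣ_     = λ x a → Vec.map (_⊗ a) x
    ; 0ᴹ       = Vec.replicate n 0#
    ; -ᴹ_      = Vec.map neg
    }

  module _ {n : ℕ} where
    open RawModule (rawModule n) public using (_+ᴹ_; _*ₗ_; 0ᴹ; -ᴹ_)

  IsLinear : ∀ {n N} → (𝔽^ n → 𝔽^ N) → Set
  IsLinear {n} {N} = ModuleMorphisms.IsModuleHomomorphism (rawModule n) (rawModule N)

  vectors : ∀ n → List (𝔽^ n)
  vectors zero    = [] ∷ []
  vectors (suc n) = List.cartesianProductWith _∷_ elements (vectors n)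

  ∈-vectors : ∀ {n} (x : 𝔽^ n) → x ∈ vectors n
  ∈-vectors []      = here refl
  ∈-vectors (a ∷ x) = ∈-cartesianProductWith⁺ _∷_ (∈-elements a) (∈-vectors x)

  -- 𝔽^ n is finite, so its subsets are the decidable ones.
  Subset : ℕ → Set
  Subset n = 𝔽^ n → Bool

  infix 4 _∈ˢ_
  _∈ˢ_ : ∀ {n} → 𝔽^ n → Subset n → Set
  x ∈ˢ S = T (S x)

  members : ∀ {n} → Subset n → List (𝔽^ n)
  members {n} S = List.filterᵇ S (vectors n)

  ∣_∣ : ∀ {n} → Subset n → ℕ
  ∣ S ∣ = List.length (members S)

  infixr 7 _∩_
  _∩_ : ∀ {n} → Subset n → Subset n → Subset n
  (S ∩ T) x = S x ∧ T x

  -- v + W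
  translate : ∀ {n} → 𝔽^ n → Subset n → Subset n
  translate v W x = W (x +ᴹ (-ᴹ v))

  record IsSubspace {n} (W : Subset n) : Set where
    field
      0-closed : 0ᴹ ∈ˢ W
      +-closed : ∀ {x y} → x ∈ˢ W → y ∈ˢ W → x +ᴹ y ∈ˢ W
      *-closed : ∀ a {x} → x ∈ˢ W → a *ₗ x ∈ˢ W

  combination : ∀ {n k} → Vec Carrier k → Vec (𝔽^ n) k → 𝔽^ n
  combination []       []       = 0ᴹ
  combination (a ∷ as) (x ∷ xs) = (a *ₗ x) +ᴹ combination as xs

  record IsBasis {n k} (xs : Vec (𝔽^ n) k) (W : Subset n) : Set where
    field
      contained   : ∀ i → Vec.lookup xs i ∈ˢ W
      independent : ∀ as → combination as xs ≡ 0ᴹ → as ≡ 0ᴹ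
      spanning    : ∀ {x} → x ∈ˢ W → ∃ λ as → combination as xs ≡ x

  HasDimension : ∀ {n} → ℕ → Subset n → Set
  HasDimension {n} k W = ∃ λ (xs : Vec (𝔽^ n) k) → IsBasis xs W

  IsFurstenberg : ∀ {n} → ℕ → ℕ → Subset n → Set
  IsFurstenberg k m S = ∀ W → IsSubspace W → HasDimension k W → ∃ λ v → m ℕ.≤ ∣ S ∩ translate v W ∣

  Pr[_≡_] : ∀ {N} → RandomVariable (𝔽^ N) → 𝔽^ N → ℝ
  Pr[ R ≡ w ] = Σℝ λ ω → if does (Vec.≡-dec _≟_ (value R ω) w) then weight R ω else 0ℝ

  maxPr : ∀ {N} → RandomVariable (𝔽^ N) → ℝ
  maxPr {N} R = maxℝ (List.map (λ w → Pr[ R ≡ w ]) (vectors N))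

  opaque
    maxPr-pos : ∀ {N} (R : RandomVariable (𝔽^ N)) → 0ℝ <ℝ maxPr R
    maxPr-pos {N} R = go (∈-vectors (value R ω₀))
      where
      0<Σ : 0ℝ <ℝ Σℝ (weight R)
      0<Σ = positive-ℝ 0<½ (L-⊆ (proj₂ (total R)) (1ℚ , *<* (ℤ.+<+ (ℕ.s≤s (ℕ.s≤s ℕ.z≤n))) , refl))
      ω₀ : Fin (size R)
      ω₀ = proj₁ (Σℝ-pos⁻ (weight R) 0<Σ)
      0<ω₀ : 0ℝ <ℝ weight R ω₀
      0<ω₀ = proj₂ (Σℝ-pos⁻ (weight R) 0<Σ)
      term : Fin (size R) → ℝ
      term ω = if does (Vec.≡-dec _≟_ (value R ω) (value R ω₀)) then weight R ω else 0ℝ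
      0≤term : ∀ ω → 0ℝ ≤ℝ term ω
      0≤term ω with Vec.≡-dec _≟_ (value R ω) (value R ω₀)
      ... | yes _ = nonNeg R ω
      ... | no  _ = ≤ℝ-refl
      0<term : 0ℝ <ℝ term ω₀
      0<term with Vec.≡-dec _≟_ (value R ω₀) (value R ω₀)
      ... | yes _ = 0<ω₀
      ... | no ≢  = ⊥-elim (≢ refl)
      go : ∀ {ws} → value R ω₀ ∈ ws → 0ℝ <ℝ maxℝ (List.map (λ w → Pr[ R ≡ w ]) ws)
      go {w ∷ ws} (here refl) =
        ⊔ℝ-posˡ (maxℝ (List.map (λ w → Pr[ R ≡ w ]) ws)) (Σℝ-pos⁺ term 0≤term ω₀ 0<term)
      go {w ∷ ws} (there p)   = ⊔ℝ-posʳ Pr[ R ≡ w ] (go p)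

  minEntropy : ∀ {N} → RandomVariable (𝔽^ N) → ℝ
  minEntropy R = -ℝ (logq (maxPr R) (maxPr-pos R))

  uniform : ∀ {n} (S : Subset n) → .{{ℕ.NonZero ∣ S ∣}} → RandomVariable (𝔽^ n)
  uniform S = record
    { size   = ∣ S ∣
    ; weight = λ _ → fromℚ (pos 1 / ∣ S ∣)
    ; value  = List.lookup (members S)
    ; nonNeg = λ _ → fromℚ-mono (1/n-nonNeg ∣ S ∣)
    ; total  = subst (λ z → Σℝ {∣ S ∣} (λ _ → fromℚ (pos 1 / ∣ S ∣)) ≈ℝ fromℚ z) (n*1/n ∣ S ∣)
                     (Σℝ-const ∣ S ∣ (pos 1 / ∣ S ∣))
    }

  StatementA : (n k : ℕ) → .{{ℕ.NonZero k}} → ℝ → Set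
  StatementA n k C = ∀ m → .{{_ : ℕ.NonZero m}} → (S : Subset n) → IsFurstenberg k m S →
    C *ℝ (m ^ℝ fromℚ (pos n / k)) ≤ℝ fromℕℝ ∣ S ∣

  -- S is nonempty, as the uniform distribution requires, because its size is a power of q.
  StatementB : (n k : ℕ) → ℝ → Set₁
  StatementB n k D = ∀ δ → 0ℝ ≤ℝ δ → δ ≤ℝ 1ℝ → (S : Subset n) →
    (size : fromℕℝ ∣ S ∣ ≈ℝ (q ^ℝ (δ *ℝ fromℕℝ n))) →
    ∃ λ (φ : 𝔽^ n → 𝔽^ (n ℕ.∸ k)) → IsLinear φ × Surjective _≡_ _≡_ φ ×
      δ *ℝ fromℕℝ (n ℕ.∸ k) -ℝ D
        ≤ℝ minEntropy (φ ⟨ uniform S {{power-≉0 ∣ S ∣ q (δ *ℝ fromℕℝ n) size}} ⟩)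

module Submission where

-- Let M be the largest number for which S is (k,M)-Furstenberg. By maximality some
-- k-dimensional subspace W has no translate meeting S in more than M points. Take for the
-- onto linear map one whose kernel lies in W: each of its fibres lies in a translate of W, so
-- the largest probability P of the image of the uniform distribution is at most M / |S|.
-- Statement A bounds M by C * M^(n/k) ≤ |S|. Taking logarithms to base q, and with
-- log |S| = δ * n, this gives
--
--   log P ≤ log M - log |S| ≤ (k/n) * (log |S| + log (1/C)) - log |S|
--         =  (k/n) * log (1/C) - δ * (n - k),
--
-- which is the claim.
--
-- M exists constructively because everything is finite. A number m is "rich" when every
-- independent k-tuple has a translate of its span meeting S in at least m points; richness is
-- decided by searching through all tuples, 1 is rich, |S| + 1 is not, and richness implies the
-- Furstenberg property (furstenberg-threshold). The onto map is built one vector of the tuple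
-- at a time, each step dividing out the nonzero image of the next vector (quotient-by-span).
--
-- The logarithmic computation is carried out on rational bounds (entropy-bound). An inequality
-- of reals holds once each rational lower bound of the left side is at most each rational upper
-- bound of the right side, and for logarithms and powers such bounds unfold to inequalities
-- q^e ≤ s or t ≤ q^g with rational exponents. Statement A becomes l^k * M^n ≤ |S|^k for rational
-- 0 < l < C (clear-root). The inequality between exponents then follows from one between
-- rational numbers (power-comparison, exponent-order).

open import Defs
open import Algebra.Bundles using (CommutativeRing; AbelianGroup)
import Algebra.Module.Morphism.Structures
import Algebra.Properties.AbelianGroup
import Algebra.Properties.CommutativeSemigroup
import Algebra.Properties.Ring
open import Algebra.Structures using (IsCommutativeRing)
open import Data.Bool.Base using (Bool; true; false; T; _∧_; if_then_else_)
open import Data.Empty using (⊥-elim)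
open import Data.Fin.Base using (zero; suc)
import Data.Fin.Properties as Fin
open import Data.Integer using (+_)
open import Data.Integer.Base as ℤ using (_⊖_) renaming (+_ to pos)
import Data.Integer.Properties as ℤ
open import Data.Integer.Solver using () renaming (module +-*-Solver to ℤSolver)
open import Data.List.Base as List using ([]; _∷_; length; filterᵇ)
open import Data.List.Membership.Propositional using (_∈_)
open import Data.List.Relation.Unary.Any using (here; there)
open import Data.Nat.Base as ℕ using (ℕ; zero; suc; NonZero; z≤n; s≤s)
import Data.Nat.Properties as ℕ
open import Data.Product.Base using (∃; ∃₂; _×_; _,_; proj₁; proj₂)
open import Data.Rational using (_/_)
import Data.Rational.Base as ℚ
import Data.Rational.Properties as ℚ
open import Data.Rational.Solver using (module +-*-Solver)
import Data.Rational.Unnormalised.Base as ℚᵘ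
import Data.Rational.Unnormalised.Properties as ℚᵘ
open import Data.Sum.Base using (_⊎_; inj₁; inj₂)
open import Data.Vec.Base as Vec using (Vec; []; _∷_)
import Data.Vec.Properties as Vec
open import Function.Base using (id; _∘_; _$_; case_of_)
open import Function.Bundles using (module Inverse)
open import Level using (0ℓ)
open import Relation.Binary.PropositionalEquality
  using (_≡_; _≢_; refl; sym; trans; cong; cong₂; subst; subst₂; isEquivalence; module ≡-Reasoning)
open import Relation.Nullary using (Dec; yes; no; ¬_)
open import Relation.Nullary.Decidable using (does; map′; ¬?; _→-dec_; decidable-stable)
open import Relation.Unary using (Decidable)

open RationalLemmas
open ℝ
open _≤ℝ_

module RealEstimates where

  open import Data.Rational.Base using (ℚ; 0ℚ; 1ℚ; _+_; _*_; _-_; -_; _<_; _≤_; _⊔_)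
  open import Algebra.Properties.CommutativeSemiring.Exp
    (CommutativeRing.commutativeSemiring ℚ.+-*-commutativeRing)
    using (_^_; ^-homo-*; ^-assocʳ; ^-distrib-*)
  open PowerLemmas

  -- Powers with rational exponents

  /-+ : ∀ i d j e → i / suc d + j / suc e ≡ (i ℤ.* pos (suc e) ℤ.+ j ℤ.* pos (suc d)) / (suc d ℕ.* suc e)
  /-+ i d j e = ℚ.toℚᵘ-injective $
    ℚᵘ.≃-trans (ℚ.toℚᵘ-homo-+ (i / suc d) (j / suc e)) $
    ℚᵘ.≃-trans (ℚᵘ.+-cong (toℚᵘ-/ i d) (toℚᵘ-/ j e)) $
    ℚᵘ.≃-sym (toℚᵘ-/ (i ℤ.* pos (suc e) ℤ.+ j ℤ.* pos (suc d)) (e ℕ.+ d ℕ.* suc e))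

  ⊖-combine : ∀ m n D m′ n′ D′ →
    (m ⊖ n) ℤ.* pos D′ ℤ.+ (m′ ⊖ n′) ℤ.* pos D ≡ (m ℕ.* D′ ℕ.+ m′ ℕ.* D) ⊖ (n ℕ.* D′ ℕ.+ n′ ℕ.* D)
  ⊖-combine m n D m′ n′ D′ = begin
    (m ⊖ n) ℤ.* pos D′ ℤ.+ (m′ ⊖ n′) ℤ.* pos D
      ≡⟨ cong₂ (λ i j → i ℤ.* pos D′ ℤ.+ j ℤ.* pos D) (sym (ℤ.m-n≡m⊖n m n)) (sym (ℤ.m-n≡m⊖n m′ n′)) ⟩
    (pos m ℤ.- pos n) ℤ.* pos D′ ℤ.+ (pos m′ ℤ.- pos n′) ℤ.* pos D
      ≡⟨ regroup (pos m) (pos n) (pos D) (pos m′) (pos n′) (pos D′) ⟩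
    (pos m ℤ.* pos D′ ℤ.+ pos m′ ℤ.* pos D) ℤ.- (pos n ℤ.* pos D′ ℤ.+ pos n′ ℤ.* pos D)
      ≡⟨ sym (cong₂ ℤ._-_ (cong₂ ℤ._+_ (ℤ.pos-* m D′) (ℤ.pos-* m′ D)) (cong₂ ℤ._+_ (ℤ.pos-* n D′) (ℤ.pos-* n′ D))) ⟩
    pos (m ℕ.* D′ ℕ.+ m′ ℕ.* D) ℤ.- pos (n ℕ.* D′ ℕ.+ n′ ℕ.* D)
      ≡⟨ ℤ.m-n≡m⊖n (m ℕ.* D′ ℕ.+ m′ ℕ.* D) (n ℕ.* D′ ℕ.+ n′ ℕ.* D) ⟩
    (m ℕ.* D′ ℕ.+ m′ ℕ.* D) ⊖ (n ℕ.* D′ ℕ.+ n′ ℕ.* D) ∎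
    where
    open ≡-Reasoning
    regroup : ∀ m n D m′ n′ D′ →
      (m ℤ.- n) ℤ.* D′ ℤ.+ (m′ ℤ.- n′) ℤ.* D ≡ (m ℤ.* D′ ℤ.+ m′ ℤ.* D) ℤ.- (n ℤ.* D′ ℤ.+ n′ ℤ.* D)
    regroup = solve 6 (λ m n D m′ n′ D′ →
      (m :- n) :* D′ :+ (m′ :- n′) :* D := (m :* D′ :+ m′ :* D) :- (n :* D′ :+ n′ :* D)) refl
      where open ℤSolver

  -- The sum of two exponents, in the form in which PowAtMost and PowAtLeast present exponents.
  exponent-+ : ∀ m n d m′ n′ d′ → let D = suc d ; D′ = suc d′ in
    (m ⊖ n) / D + (m′ ⊖ n′) / D′ ≡ ((m ℕ.* D′ ℕ.+ m′ ℕ.* D) ⊖ (n ℕ.* D′ ℕ.+ n′ ℕ.* D)) / (D ℕ.* D′)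
  exponent-+ m n d m′ n′ d′ = trans (/-+ (m ⊖ n) d (m′ ⊖ n′) d′)
    (cong (_/ (suc d ℕ.* suc d′)) (⊖-combine m n (suc d) m′ n′ (suc d′)))

  -- The two sides of the product of b^m ≤ s^D * b^n and b^m′ ≤ s′^D′ * b^n′, raised to the
  -- powers D′ and D to have the common denominator D * D′ in the exponents.
  base-combine : ∀ β m m′ D D′ → (β ^ m) ^ D′ * (β ^ m′) ^ D ≡ β ^ (m ℕ.* D′ ℕ.+ m′ ℕ.* D)
  base-combine β m m′ D D′ = trans (cong₂ _*_ (^-assocʳ β m D′) (^-assocʳ β m′ D))
    (sym (^-homo-* β (m ℕ.* D′) (m′ ℕ.* D)))

  value-combine : ∀ β s s′ n n′ D D′ →
    (s ^ D * β ^ n) ^ D′ * (s′ ^ D′ * β ^ n′) ^ D ≡ (s * s′) ^ (D ℕ.* D′) * β ^ (n ℕ.* D′ ℕ.+ n′ ℕ.* D)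
  value-combine β s s′ n n′ D D′ = begin
    (s ^ D * β ^ n) ^ D′ * (s′ ^ D′ * β ^ n′) ^ D
      ≡⟨ cong₂ _*_ (^-raise s D β n D′)
           (trans (^-raise s′ D′ β n′ D) (cong (λ e → s′ ^ e * β ^ (n′ ℕ.* D)) (ℕ.*-comm D′ D))) ⟩
    (s ^ E * β ^ (n ℕ.* D′)) * (s′ ^ E * β ^ (n′ ℕ.* D))
      ≡⟨ swap (s ^ E) (β ^ (n ℕ.* D′)) (s′ ^ E) (β ^ (n′ ℕ.* D)) ⟩
    (s ^ E * s′ ^ E) * (β ^ (n ℕ.* D′) * β ^ (n′ ℕ.* D))
      ≡⟨ sym (cong₂ _*_ (^-distrib-* s s′ E) (^-homo-* β (n ℕ.* D′) (n′ ℕ.* D))) ⟩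
    (s * s′) ^ E * β ^ (n ℕ.* D′ ℕ.+ n′ ℕ.* D) ∎
    where
    open ≡-Reasoning
    E : ℕ
    E = D ℕ.* D′
    swap : ∀ a b c d → (a * b) * (c * d) ≡ (a * c) * (b * d)
    swap = solve 4 (λ a b c d → (a :* b) :* (c :* d) := (a :* c) :* (b :* d)) refl where open +-*-Solver

  -- PowAtMost and PowAtLeast respect products and natural powers, as b^e does.
  module _ {b : ℕ} .{{_ : NonZero b}} where

    private
      β : ℚ
      β = fromℕ b

      0<β^ : ∀ n → 0ℚ < β ^ n
      0<β^ n = ^-pos n (ℚ.<-≤-trans 0<1 (1≤base b))

      0<rhs : ∀ {s} d n → 0ℚ < s → 0ℚ < s ^ suc d * β ^ n
      0<rhs d n 0<s = *-pos (^-pos (suc d) 0<s) (0<β^ n)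

      powers-≤ : ∀ {x y x′ y′} D D′ → 0ℚ < x → 0ℚ < x′ → x ≤ y → x′ ≤ y′ → x ^ D′ * x′ ^ D ≤ y ^ D′ * y′ ^ D
      powers-≤ D D′ 0<x 0<x′ x≤y x′≤y′ =
        *-mono (ℚ.<⇒≤ (^-pos D′ 0<x)) (ℚ.<⇒≤ (^-pos D (ℚ.<-≤-trans 0<x′ x′≤y′)))
          (^-mono D′ 0<x x≤y) (^-mono D 0<x′ x′≤y′)

    AtMost-+ : ∀ {e e′ s s′} → PowAtMost b e s → PowAtMost b e′ s′ → PowAtMost b (e + e′) (s * s′)
    AtMost-+ {s = s} {s′} (m , n , d , refl , p) (m′ , n′ , d′ , refl , p′) =
      m ℕ.* suc d′ ℕ.+ m′ ℕ.* suc d , n ℕ.* suc d′ ℕ.+ n′ ℕ.* suc d , d′ ℕ.+ d ℕ.* suc d′ ,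
      exponent-+ m n d m′ n′ d′ ,
      subst₂ _≤_ (base-combine β m m′ (suc d) (suc d′)) (value-combine β s s′ n n′ (suc d) (suc d′))
        (powers-≤ (suc d) (suc d′) (0<β^ m) (0<β^ m′) p p′)

    AtLeast-+ : ∀ {e e′ s s′} → 0ℚ < s → 0ℚ < s′ →
                PowAtLeast b e s → PowAtLeast b e′ s′ → PowAtLeast b (e + e′) (s * s′)
    AtLeast-+ {s = s} {s′} 0<s 0<s′ (m , n , d , refl , p) (m′ , n′ , d′ , refl , p′) =
      m ℕ.* suc d′ ℕ.+ m′ ℕ.* suc d , n ℕ.* suc d′ ℕ.+ n′ ℕ.* suc d , d′ ℕ.+ d ℕ.* suc d′ ,
      exponent-+ m n d m′ n′ d′ ,
      subst₂ _≤_ (value-combine β s s′ n n′ (suc d) (suc d′)) (base-combine β m m′ (suc d) (suc d′))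
        (powers-≤ (suc d) (suc d′) (0<rhs d n 0<s) (0<rhs d′ n′ 0<s′) p p′)

    private
      suc-* : ∀ j e → e + fromℕ j * e ≡ fromℕ (suc j) * e
      suc-* j e = sym (trans (cong (_* e) (fromℕ-suc j))
        (trans (ℚ.*-distribʳ-+ e 1ℚ (fromℕ j)) (cong (_+ fromℕ j * e) (ℚ.*-identityˡ e))))

    AtMost-* : ∀ {e s} j → PowAtMost b e s → PowAtMost b (fromℕ j * e) (s ^ j)
    AtMost-* {e} zero    p = 0 , 0 , 0 , ℚ.*-zeroˡ e , ℚ.≤-refl
    AtMost-* {e} {s} (suc j) p =
      subst (λ f → PowAtMost b f (s ^ suc j)) (suc-* j e) (AtMost-+ {s = s} {s ^ j} p (AtMost-* j p))

    AtLeast-* : ∀ {e s} j → 0ℚ < s → PowAtLeast b e s → PowAtLeast b (fromℕ j * e) (s ^ j)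
    AtLeast-* {e} zero    0<s p = 0 , 0 , 0 , ℚ.*-zeroˡ e , ℚ.≤-refl
    AtLeast-* {e} {s} (suc j) 0<s p =
      subst (λ f → PowAtLeast b f (s ^ suc j)) (suc-* j e)
        (AtLeast-+ {s = s} {s ^ j} 0<s (^-pos j 0<s) p (AtLeast-* j 0<s p))

    AtLeast-ℕ : ∀ j → PowAtLeast b (fromℕ j) (β ^ j)
    AtLeast-ℕ j = j , 0 , 0 , refl , ℚ.≤-reflexive (trans (ℚ.*-identityʳ _) (ℚ.*-identityʳ _))

    -- If b^e ≤ s < s′ ≤ b^e′ then e ≤ e′.
    exponent-order : ∀ {e e′ s s′} → 0ℚ < s → s < s′ → PowAtMost b e s → PowAtLeast b e′ s′ → e ≤ e′
    exponent-order 0<s s<s′ p p′ = ℚ.≮⇒≥ λ e′<e →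
      ℚ.<-irrefl refl (ℚ.<-≤-trans s<s′ (pow-order (ℚ.<-trans 0<s s<s′) 0<s e′<e p′ p))

  -- Bounds of sums, products, powers and logarithms of real numbers

  -- The non-strict p ≤ r suffices because lower cuts are open.
  ≤ℝ-from-bounds : ∀ {x y} → (∀ {p r} → L x p → U y r → p ≤ r) → x ≤ℝ y
  ≤ℝ-from-bounds {x} {y} p≤r = L-mono λ Lp →
    let p′ , p<p′ , Lp′ = L-open x Lp
        p″ , p<p″ , p″<p′ = between p<p′
    in case located y p<p″ of λ where
      (inj₁ Lyp) → Lyp
      (inj₂ Uy)  → ⊥-elim (ℚ.<-irrefl refl (ℚ.<-≤-trans p″<p′ (p≤r Lp′ Uy)))

  L-fromℚ : ∀ {c p} → L (fromℚ c) p → p < c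
  L-fromℚ (_ , p<c , refl) = p<c

  U-⊇ : ∀ {x y} → x ≤ℝ y → ∀ {r} → U y r → U x r
  U-⊇ {x} {y} x≤y Ur =
    let r′ , r′<r , Ur′ = U-open y Ur
    in case located x r′<r of λ where
      (inj₁ Lr′) → ⊥-elim (disjoint y (L-⊆ x≤y Lr′) Ur′)
      (inj₂ Uxr) → Uxr

  -- A bound of the product is a bound of all four products of endpoints. The interval around the
  -- constant c contains c itself, so it also bounds a * c, for an endpoint a of the interval
  -- around x.
  L-*-const : ∀ x c {p} → L (x *ℝ fromℚ c) p → ∃ λ a → L x a × p < a * c
  L-*-const x c (_ , p<v , a , b , _ , _ , (La , Ub) , ((_ , c₁<c , refl) , (_ , c<c₂ , refl)) , v≤) =
    a , La , ℚ.<-≤-trans p<v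
      (≤corners⇒≤ a c ℚ.≤-refl (ℚ.<⇒≤ (L<U x La Ub)) (ℚ.<⇒≤ c₁<c) (ℚ.<⇒≤ c<c₂) v≤)

  U-*-const : ∀ x c {r} → U (x *ℝ fromℚ c) r → ∃ λ b → U x b × b * c < r
  U-*-const x c (_ , v<r , a , b , _ , _ , (La , Ub) , ((_ , c₁<c , refl) , (_ , c<c₂ , refl)) , v≥) =
    b , Ub , ℚ.≤-<-trans
      (≥corners⇒≥ b c (ℚ.<⇒≤ (L<U x La Ub)) ℚ.≤-refl (ℚ.<⇒≤ c₁<c) (ℚ.<⇒≤ c<c₂) v≥) v<r

  U-const-* : ∀ c x {r} → U (fromℚ c *ℝ x) r → ∃ λ b → U x b × c * b < r
  U-const-* c x (_ , v<r , _ , _ , a , b , ((_ , c₁<c , refl) , (_ , c<c₂ , refl)) , (La , Ub) , v≥) =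
    b , Ub , ℚ.≤-<-trans
      (≥corners⇒≥ c b (ℚ.<⇒≤ c₁<c) (ℚ.<⇒≤ c<c₂) (ℚ.<⇒≤ (L<U x La Ub)) ℚ.≤-refl v≥) v<r

  -- The converse of L-*-const for positive constants, by locatedness of the product.
  L-*-const⁺ : ∀ x {c a} → 0ℚ < c → L x a → L (x *ℝ fromℚ c) (a * c)
  L-*-const⁺ x {c} 0<c La =
    let a′ , a<a′ , La′ = L-open x La
    in case located (x *ℝ fromℚ c) (*-monoʳ-< 0<c a<a′) of λ where
      (inj₁ Lac) → Lac
      (inj₂ U′)  → let b , Ub , bc<a′c = U-*-const x c U′ in
        ⊥-elim (ℚ.<-asym bc<a′c (*-monoʳ-< 0<c (L<U x La′ Ub)))

  -- The intervals behind the upper bound r need not contain a and c; the maxima of a and c with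
  -- their lower endpoints do lie in them.
  U-product : ∀ x y {a c r} → 0ℚ ≤ a → 0ℚ ≤ c → L x a → L y c → U (x *ℝ y) r → a * c ≤ r
  U-product x y {a} {c} 0≤a 0≤c La Lc (v , v<r , a′ , b , c′ , d , (La′ , Ub) , (Lc′ , Ud) , v≥) =
    ℚ.≤-trans (*-mono 0≤a (ℚ.≤-trans 0≤c (ℚ.p≤p⊔q c c′)) (ℚ.p≤p⊔q a a′) (ℚ.p≤p⊔q c c′))
      (ℚ.≤-trans
        (≥corners⇒≥ (a ⊔ a′) (c ⊔ c′)
          (ℚ.p≤q⊔p a a′) (ℚ.<⇒≤ (L<U x (L-max x La La′) Ub))
          (ℚ.p≤q⊔p c c′) (ℚ.<⇒≤ (L<U y (L-max y Lc Lc′) Ud)) v≥)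
        (ℚ.<⇒≤ v<r))

  product≤ : ∀ x y {a c N} → 0ℚ ≤ a → 0ℚ ≤ c → L x a → L y c → x *ℝ y ≤ℝ fromℚ N → a * c ≤ N
  product≤ x y {a} {c} {N} 0≤a 0≤c La Lc xy≤N = ℚ.≮⇒≥ λ N<ac →
    let m , N<m , m<ac = between N<ac
    in ℚ.<-irrefl refl (ℚ.<-≤-trans m<ac (U-product x y 0≤a 0≤c La Lc (U-⊇ xy≤N (N , N<m , refl))))

  -- Positive reals can be approximated within any ratio c > 1.
  approx-ratio : ∀ x {c} → 0ℝ <ℝ x → 1ℚ < c → ∃₂ λ a b → 0ℚ < a × L x a × U x b × b ≤ c * a
  approx-ratio x {c} 0<x 1<c =
    let l , 0<l , Ll = pos-lower 0<x
        a , b , La , Ub , b≤ = approx x (*-pos 0<c-1 0<l)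
        a≤ = ℚ.p≤p⊔q a l
        l≤ = ℚ.p≤q⊔p a l
    in a ⊔ l , b , ℚ.<-≤-trans 0<l l≤ , L-max x La Ll , Ub ,
       ℚ.≤-trans b≤ (ℚ.≤-trans (ℚ.+-mono-≤ a≤ (*-monoˡ (ℚ.<⇒≤ 0<c-1) l≤)) (ℚ.≤-reflexive (collect c (a ⊔ l))))
    where
    0<c-1 : 0ℚ < c - 1ℚ
    0<c-1 = 0<q-p 1<c
    collect : ∀ c a → a + (c - 1ℚ) * a ≡ c * a
    collect = solve 2 (λ c a → a :+ (c :- con 1ℚ) :* a := c :* a) refl where open +-*-Solver

  -- Only this half of the inverse relation between powers and logarithms is needed.
  ^ℝ≤⇒≤log : ∀ b .{{_ : ℕ.NonTrivial b}} .{{_ : NonZero b}} {x y} (0<y : 0ℝ <ℝ y) → b ^ℝ x ≤ℝ y → x ≤ℝ log b y 0<y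
  ^ℝ≤⇒≤log b {x} {y} 0<y b^x≤y = ≤ℝ-from-bounds λ {p} {r} Lp (e , e<r , s , 0<s , Us , s≤b^e) →
    ℚ.≮⇒≥ λ r<p →
      let s′ , s′<s , Us′ = U-open y Us
          Le = L-lower x (ℚ.<-trans e<r r<p) Lp
      in disjoint y (L-⊆ b^x≤y (s , s′<s , 0<s , e , Le , s≤b^e)) Us′

  k*[n/k] : ∀ n k .{{_ : NonZero k}} → fromℕ k * (pos n / k) ≡ fromℕ n
  k*[n/k] n (suc k) = ℚ.toℚᵘ-injective
    (ℚᵘ.≃-trans (ℚ.toℚᵘ-homo-* (fromℕ (suc k)) (pos n / suc k))
    (ℚᵘ.≃-trans (ℚᵘ.*-cong (toℚᵘ-/ (pos (suc k)) 0) (toℚᵘ-/ (pos n) k))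
    (ℚᵘ.≃-trans (ℚᵘ.*≡* eq) (ℚᵘ.≃-sym (toℚᵘ-/ (pos n) 0)))))
    where
    eq : (pos (suc k) ℤ.* pos n) ℤ.* pos 1 ≡ pos n ℤ.* pos (suc (k ℕ.+ 0))
    eq = trans (ℤ.*-identityʳ _) (trans (ℤ.*-comm (pos (suc k)) (pos n))
       (cong (λ z → pos n ℤ.* pos (suc z)) (sym (ℕ.+-identityʳ k))))

  0<fromℕ : ∀ n .{{_ : NonZero n}} → 0ℚ < fromℕ n
  0<fromℕ n = ℚ.<-≤-trans 0<1 (1≤base n)

  fromℕ-mono : ∀ {m n} → m ℕ.≤ n → fromℕ m ≤ fromℕ n
  fromℕ-mono {n = n} z≤n = fromℕ-nonNeg n
  fromℕ-mono (s≤s {m} {n} m≤n) = subst₂ _≤_ (sym (fromℕ-suc m)) (sym (fromℕ-suc n))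
    (ℚ.+-monoʳ-≤ 1ℚ (fromℕ-mono m≤n))

  -- Every rational upper bound u of M^(n/k) satisfies M^n ≤ u^k.
  U-power : ∀ M n k .{{_ : NonZero M}} .{{_ : NonZero k}} {u} → U (M ^ℝ fromℚ (pos n / k)) u → fromℕ M ^ n ≤ u ^ k
  U-power M n k {u} (s , s<u , 0<s , e , (_ , n/k<e , refl) , b^e≤s) =
    ℚ.≤-trans
      (pow-order {M} (^-pos n (0<fromℕ M)) (^-pos k 0<s)
         (subst (_< fromℕ k * e) (k*[n/k] n k) (*-monoˡ-< (0<fromℕ k) n/k<e))
         (AtLeast-ℕ {M} n) (AtMost-* {M} k b^e≤s))
      (^-mono k 0<s (ℚ.<⇒≤ s<u))

  -- C * M^(n/k) ≤ N, with the root cleared, for each rational l below C. An upper bound b of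
  -- M^(n/k) is needed to compare with M^n, while the hypothesis concerns lower bounds a; the
  -- room between l and some l′ < C absorbs the ratio b / a ≤ l′ / l, so that l * b ≤ l′ * a ≤ N.
  clear-root : ∀ C M n k N .{{_ : NonZero M}} .{{_ : NonZero k}} →
    C *ℝ (M ^ℝ fromℚ (pos n / k)) ≤ℝ fromℚ N → ∀ {l} → 0ℚ < l → L C l → l ^ k * fromℕ M ^ n ≤ N ^ k
  clear-root C M n k N CM≤N {l} 0<l Ll =
    let l′ , l<l′ , Ll′ = L-open C Ll
        r , 0<r , rl≡1 = recip 0<l
        1<l′r = subst (_< l′ * r) (trans (ℚ.*-comm l r) rl≡1) (*-monoʳ-< 0<r l<l′)
        a , b , 0<a , La , Ub , b≤ = approx-ratio M^ (^ℝ-pos M (fromℚ (pos n / k))) 1<l′r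
        0<b = ℚ.<-trans 0<a (L<U M^ La Ub)
        lb≤N = ℚ.≤-trans
          (ℚ.≤-trans (*-monoˡ (ℚ.<⇒≤ 0<l) b≤) (ℚ.≤-reflexive (trans (regroup l l′ r a)
            (trans (cong (_* (l′ * a)) rl≡1) (ℚ.*-identityˡ (l′ * a))))))
          (product≤ C M^ (ℚ.<⇒≤ (ℚ.<-trans 0<l l<l′)) (ℚ.<⇒≤ 0<a) Ll′ La CM≤N)
    in ℚ.≤-trans (*-monoˡ (ℚ.<⇒≤ (^-pos k 0<l)) (U-power M n k Ub))
         (subst (_≤ N ^ k) (^-distrib-* l b k) (^-mono k (*-pos 0<l 0<b) lb≤N))
    where
    M^ : ℝ
    M^ = M ^ℝ fromℚ (pos n / k)
    regroup : ∀ l l′ r a → l * (l′ * r * a) ≡ (r * l) * (l′ * a)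
    regroup = solve 4 (λ l l′ r a → l :* (l′ :* r :* a) := (r :* l) :* (l′ :* a)) refl where open +-*-Solver

  -- The multiplicative form of the entropy estimate: in the application ν = |S|, μ = M, s is a
  -- lower bound of P, s₁ one of |S|, l one of C, and t an upper bound of 1 / C. Multiply by
  -- ν^k * l^k and use ν^d * ν^k = ν^n.
  power-comparison : ∀ n k d .{{_ : NonZero n}} → n ≡ k ℕ.+ d → ∀ {ν μ s s₁ t l} →
    0ℚ < ν → 0ℚ < s → 0ℚ < s₁ → 0ℚ < t → 0ℚ < l →
    s * ν < μ → s₁ ≤ ν → 1ℚ ≤ t * l → l ^ k * μ ^ n ≤ ν ^ k →
    s ^ n * s₁ ^ d < t ^ k
  power-comparison n@(suc n-1) k d n≡k+d {ν} {μ} {s} {s₁} {t} {l} 0<ν 0<s 0<s₁ 0<t 0<l sν<μ s₁≤ν 1≤tl lμ≤ν =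
    ℚ.*-cancelʳ-<-nonNeg (ν ^ k * l ^ k) {{ℚ.nonNegative (ℚ.<⇒≤ 0<Z)}} (begin-strict
      s ^ n * s₁ ^ d * (ν ^ k * l ^ k)
        ≤⟨ *-monoʳ (ℚ.<⇒≤ 0<Z) (*-monoˡ (ℚ.<⇒≤ (^-pos n 0<s)) (^-mono d 0<s₁ s₁≤ν)) ⟩
      s ^ n * ν ^ d * (ν ^ k * l ^ k)
        ≡⟨ regroup (s ^ n) (ν ^ d) (ν ^ k) (l ^ k) ⟩
      s ^ n * (ν ^ k * ν ^ d) * l ^ k
        ≡⟨ cong (λ z → s ^ n * z * l ^ k) (trans (sym (^-homo-* ν k d)) (cong (ν ^_) (sym n≡k+d))) ⟩
      s ^ n * ν ^ n * l ^ k
        ≡⟨ cong (_* l ^ k) (sym (^-distrib-* s ν n)) ⟩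
      (s * ν) ^ n * l ^ k
        <⟨ *-monoʳ-< (^-pos k 0<l) (^-mono-< n-1 (*-pos 0<s 0<ν) sν<μ) ⟩
      μ ^ n * l ^ k
        ≡⟨ ℚ.*-comm (μ ^ n) (l ^ k) ⟩
      l ^ k * μ ^ n
        ≤⟨ lμ≤ν ⟩
      ν ^ k
        ≡⟨ sym (ℚ.*-identityˡ (ν ^ k)) ⟩
      1ℚ * ν ^ k
        ≤⟨ *-monoʳ (ℚ.<⇒≤ (^-pos k 0<ν)) (1≤^ k 1≤tl) ⟩
      (t * l) ^ k * ν ^ k
        ≡⟨ cong (_* ν ^ k) (^-distrib-* t l k) ⟩
      t ^ k * l ^ k * ν ^ k
        ≡⟨ trans (ℚ.*-assoc (t ^ k) (l ^ k) (ν ^ k)) (cong (t ^ k *_) (ℚ.*-comm (l ^ k) (ν ^ k))) ⟩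
      t ^ k * (ν ^ k * l ^ k) ∎)
    where
    open ℚ.≤-Reasoning
    0<Z : 0ℚ < ν ^ k * l ^ k
    0<Z = *-pos (^-pos k 0<ν) (^-pos k 0<l)
    regroup : ∀ a b c d → a * b * (c * d) ≡ a * (c * b) * d
    regroup = solve 4 (λ a b c d → a :* b :* (c :* d) := a :* (c :* b) :* d) refl where open +-*-Solver

  -- The inequality between exponents is n times the entropy estimate; this divides by n. In the
  -- application ν = n, ρ = n - k and κ = k / n, and a is a lower bound of log |S|.
  scaled-inequality : ∀ {ν ρ κ a x g e p} → 0ℚ < ν → 0ℚ ≤ ρ →
    ν * e + ρ * a ≤ ν * κ * g → x * ν ≤ a → p ≤ x * ρ - κ * g → p ≤ - e
  scaled-inequality {ν} {ρ} {κ} {a} {x} {g} {e} {p} 0<ν 0≤ρ bound xν≤a p≤ = *-cancelˡ 0<ν (begin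
    ν * p                              ≤⟨ *-monoˡ (ℚ.<⇒≤ 0<ν) p≤ ⟩
    ν * (x * ρ - κ * g)                ≡⟨ expand-left ν x ρ κ g ⟩
    ρ * (x * ν) - ν * κ * g            ≤⟨ ℚ.+-monoˡ-≤ (- (ν * κ * g)) (*-monoˡ 0≤ρ xν≤a) ⟩
    ρ * a - ν * κ * g                  ≤⟨ ℚ.+-monoʳ-≤ (ρ * a) (ℚ.neg-antimono-≤ bound) ⟩
    ρ * a - (ν * e + ρ * a)            ≡⟨ cancel ν e (ρ * a) ⟩
    ν * - e                            ∎)
    where
    open ℚ.≤-Reasoning
    open +-*-Solver
    expand-left : ∀ ν x ρ κ g → ν * (x * ρ - κ * g) ≡ ρ * (x * ν) - ν * κ * g
    expand-left = solve 5 (λ ν x ρ κ g → ν :* (x :* ρ :- κ :* g) := ρ :* (x :* ν) :- ν :* κ :* g) refl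
    cancel : ∀ ν e z → z - (ν * e + z) ≡ ν * - e
    cancel = solve 3 (λ ν e z → z :- (ν :* e :+ z) := ν :* :- e) refl

  -- The analytic part of the theorem: M^(n/k) ≤ N / C, b^(δ * n) ≤ N and P ≤ M / N imply
  -- δ * (n - k) - (k/n) * log (1/C) ≤ - log P. In the proof e, e₁ and g are rational bounds of
  -- log P from below, of log N from below and of log (1/C) from above.
  entropy-bound : ∀ b .{{_ : ℕ.NonTrivial b}} .{{_ : NonZero b}} n k d
    .{{_ : NonZero n}} .{{_ : NonZero k}} → n ≡ k ℕ.+ d →
    ∀ N M .{{_ : NonZero N}} .{{_ : NonZero M}} {C P δ} (0<C : 0ℝ <ℝ C) (0<P : 0ℝ <ℝ P) →
    C *ℝ (M ^ℝ fromℚ (pos n / k)) ≤ℝ fromℕℝ N →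
    b ^ℝ (δ *ℝ fromℕℝ n) ≤ℝ fromℕℝ N →
    P ≤ℝ fromℚ (fromℕ M * (pos 1 / N)) →
    δ *ℝ fromℕℝ d -ℝ fromℚ (pos k / n) *ℝ log b (inv C 0<C) (inv-pos 0<C) ≤ℝ -ℝ log b P 0<P
  entropy-bound b n k d n≡k+d N M {C} {P} {δ} 0<C 0<P CM≤N b^δn≤N P≤M/N =
    ≤ℝ-from-bounds {δ *ℝ fromℕℝ d -ℝ κlog} { -ℝ log b P 0<P}
     λ { {p} {r} (_ , p<a+v , a , v , La , (_ , v<-u , u , Uu , refl) , refl)
                 (_ , -e′<r , e′ , (e , e′<e , s , 0<s , Ls , b^e≤s) , refl) →
      let x , Lx , a<xd = L-*-const δ (fromℕ d) La
          g′ , (g , g<g′ , t , 0<t , (t′ , t′<t , l , Ll , 0<l , 1≤t′l) , t≤b^g) , κg′<u =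
            U-const-* κ (log b (inv C 0<C) (inv-pos 0<C)) Uu
          e₁ , xn<e₁ , s₁ , 0<s₁ , Ls₁ , b^e₁≤s₁ =
            L-⊆ (^ℝ≤⇒≤log b 0<N b^δn≤N) (L-*-const⁺ δ (0<fromℕ n) Lx)
          exponents : fromℕ n * e + fromℕ d * e₁ ≤ fromℕ k * g
          exponents = exponent-order {b} (*-pos (^-pos n 0<s) (^-pos d 0<s₁))
            (power-comparison n k d n≡k+d (0<fromℕ N) 0<s 0<s₁ 0<t 0<l
              (sN<M Ls) (ℚ.<⇒≤ (L-fromℚ Ls₁))
              (ℚ.≤-trans 1≤t′l (*-monoʳ (ℚ.<⇒≤ 0<l) (ℚ.<⇒≤ t′<t)))
              (clear-root C M n k (fromℕ N) CM≤N 0<l Ll))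
            (AtMost-+ {b} {s = s ^ n} {s₁ ^ d} (AtMost-* {b} n b^e≤s) (AtMost-* {b} d b^e₁≤s₁))
            (AtLeast-* {b} k 0<t t≤b^g)
          p≤ : p ≤ x * fromℕ d - κ * g
          p≤ = ℚ.<⇒≤ (ℚ.<-trans p<a+v (ℚ.+-mono-< a<xd (ℚ.<-trans v<-u (ℚ.neg-antimono-<
                 (ℚ.≤-<-trans (*-monoˡ 0≤κ (ℚ.<⇒≤ g<g′)) κg′<u)))))
      in ℚ.≤-trans
           (scaled-inequality {x = x} (0<fromℕ n) (fromℕ-nonNeg d)
             (subst (λ z → fromℕ n * e + fromℕ d * e₁ ≤ z * g) (sym (k*[n/k] k n)) exponents)
             (ℚ.<⇒≤ xn<e₁) p≤)
           (ℚ.<⇒≤ (ℚ.<-trans (ℚ.neg-antimono-< e′<e) -e′<r)) }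
    where
    κ : ℚ
    κ = pos k / n
    κlog : ℝ
    κlog = fromℚ κ *ℝ log b (inv C 0<C) (inv-pos 0<C)
    0≤κ : 0ℚ ≤ κ
    0≤κ = ℚ.nonNegative⁻¹ κ {{ℚ.normalize-nonNeg k n}}
    0<N : 0ℝ <ℝ fromℕℝ N
    0<N = let m , 0<m , m<N = between (0<fromℕ N) in positive-ℝ 0<m (fromℕ N , m<N , refl)
    sN<M : ∀ {s} → L P s → s * fromℕ N < fromℕ M
    sN<M {s} Ls = subst (s * fromℕ N <_) (trans (ℚ.*-assoc (fromℕ M) (pos 1 / N) (fromℕ N))
        (trans (cong (fromℕ M *_) (trans (ℚ.*-comm (pos 1 / N) (fromℕ N)) (n*1/n N))) (ℚ.*-identityʳ (fromℕ M))))
        (*-monoʳ-< (0<fromℕ N) (L-fromℚ (L-⊆ P≤M/N Ls)))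

  -- Maxima and sums of real numbers

  ⊔ℝ-least : ∀ {x y z} → x ≤ℝ z → y ≤ℝ z → x ⊔ℝ y ≤ℝ z
  ⊔ℝ-least {z = z} x≤z y≤z = L-mono λ where
    (_ , p<a , inj₁ La) → L-lower z p<a (L-⊆ x≤z La)
    (_ , p<a , inj₂ La) → L-lower z p<a (L-⊆ y≤z La)

  maxℝ-least : ∀ {A : Set} {f : A → ℝ} {z} → 0ℝ ≤ℝ z → (∀ a → f a ≤ℝ z) → ∀ as → maxℝ (List.map f as) ≤ℝ z
  maxℝ-least 0≤z f≤z []       = 0≤z
  maxℝ-least 0≤z f≤z (a ∷ as) = ⊔ℝ-least (f≤z a) (maxℝ-least 0≤z f≤z as)

  -- The total weight of the list positions at which f holds, each of weight c.
  Σℝ-indicator : ∀ {A : Set} (f : A → Bool) c xs →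
    Σℝ (λ i → if f (List.lookup xs i) then fromℚ c else 0ℝ) ≤ℝ fromℚ (fromℕ (length (filterᵇ f xs)) * c)
  Σℝ-indicator f c []       = proj₁ (fromℚ-cong {0ℚ} {fromℕ 0 * c} (sym (ℚ.*-zeroˡ c)))
  Σℝ-indicator f c (x ∷ xs) with f x
  ... | true  = ≤ℝ-trans (+ℝ-monoʳ (fromℚ c) (Σℝ-indicator f c xs))
                  (≤ℝ-trans (proj₁ (fromℚ-+ c (r * c))) (proj₁ (fromℚ-cong (begin
                    c + r * c            ≡⟨ cong (_+ r * c) (sym (ℚ.*-identityˡ c)) ⟩
                    1ℚ * c + r * c       ≡⟨ sym (ℚ.*-distribʳ-+ c 1ℚ r) ⟩
                    (1ℚ + r) * c         ≡⟨ cong (_* c) (sym (fromℕ-suc j)) ⟩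
                    fromℕ (suc j) * c    ∎))))
    where
    open ≡-Reasoning
    j : ℕ
    j = length (filterᵇ f xs)
    r : ℚ
    r = fromℕ j
  ... | false = ≤ℝ-trans (+ℝ-monoʳ 0ℝ (Σℝ-indicator f c xs))
                  (≤ℝ-trans (proj₁ (fromℚ-+ 0ℚ z)) (proj₁ (fromℚ-cong (ℚ.+-identityˡ z))))
    where
    z : ℚ
    z = fromℕ (length (filterᵇ f xs)) * c

-- Finite search and counting

-- A type over which every decidable predicate can be searched.
Searchable : Set → Set₁
Searchable A = ∀ {P : A → Set} → Decidable P → Dec (∃ P)

search-Vec : ∀ {A} → Searchable A → ∀ n → Searchable (Vec A n)
search-Vec search zero    P? = map′ ([] ,_) (λ { ([] , p) → p }) (P? [])
search-Vec search (suc n) P? =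
  map′ (λ { (a , v , p) → a ∷ v , p }) (λ { (a ∷ v , p) → a , v , p })
    (search λ a → search-Vec search n λ v → P? (a ∷ v))

all-or-counterexample : ∀ {A} → Searchable A → {P : A → Set} → Decidable P → (∀ a → P a) ⊎ ∃ λ a → ¬ P a
all-or-counterexample search P? with search (λ a → ¬? (P? a))
... | yes bad = inj₂ bad
... | no  ¬bad = inj₁ λ a → decidable-stable (P? a) λ ¬p → ¬bad (a , ¬p)

search-all : ∀ {A} → Searchable A → {P : A → Set} → Decidable P → Dec (∀ a → P a)
search-all search P? with all-or-counterexample search P?
... | inj₁ all       = yes all
... | inj₂ (a , ¬pa) = no λ all → ¬pa (all a)

-- Search upwards from m for the first failure of P, which comes at d + m at the latest.
last-success : {P Q : ℕ → Set} → (∀ m → P m ⊎ Q m) → ∀ {m} d → P m → ¬ P (d ℕ.+ m) →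
               ∃ λ M → m ℕ.≤ M × P M × Q (suc M)
last-success P⊎Q zero    Pm ¬P = ⊥-elim (¬P Pm)
last-success {P} P⊎Q {m} (suc d) Pm ¬P with P⊎Q (suc m)
... | inj₂ Q = m , ℕ.≤-refl , Pm , Q
... | inj₁ P′ =
  let M , m<M , PM , QM = last-success P⊎Q d P′ (subst (λ j → ¬ P j) (sym (ℕ.+-suc d m)) ¬P)
  in M , ℕ.<⇒≤ m<M , PM , QM

does⇒ : ∀ {A : Set} (a? : Dec A) → T (does a?) → A
does⇒ (yes a) _ = a

⇒does : ∀ {A : Set} (a? : Dec A) → A → T (does a?)
⇒does (yes _) _ = _
⇒does (no ¬a) a = ⊥-elim (¬a a)

module _ {A : Set} where

  length-filterᵇ-mono : ∀ {f g : A → Bool} → (∀ {x} → T (f x) → T (g x)) → ∀ xs →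
                        length (filterᵇ f xs) ℕ.≤ length (filterᵇ g xs)
  length-filterᵇ-mono f⇒g []       = z≤n
  length-filterᵇ-mono {f} {g} f⇒g (x ∷ xs) with f x | g x | f⇒g {x}
  ... | false | false | _  = length-filterᵇ-mono f⇒g xs
  ... | false | true  | _  = ℕ.m≤n⇒m≤1+n (length-filterᵇ-mono f⇒g xs)
  ... | true  | false | ⇒  = ⊥-elim (⇒ _)
  ... | true  | true  | _  = s≤s (length-filterᵇ-mono f⇒g xs)

  filterᵇ-∘ : ∀ (f g : A → Bool) xs → filterᵇ f (filterᵇ g xs) ≡ filterᵇ (λ x → g x ∧ f x) xs
  filterᵇ-∘ f g []       = refl
  filterᵇ-∘ f g (x ∷ xs) with g x
  ... | false = filterᵇ-∘ f g xs
  ... | true with f x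
  ...   | false = filterᵇ-∘ f g xs
  ...   | true  = cong (x ∷_) (filterᵇ-∘ f g xs)

  filterᵇ-nonempty : ∀ {f : A → Bool} xs → 0 ℕ.< length (filterᵇ f xs) → ∃ λ x → T (f x)
  filterᵇ-nonempty {f} (x ∷ xs) 0< with f x in eq
  ... | true  = x , subst T (sym eq) _
  ... | false = filterᵇ-nonempty xs 0<

  ∈⇒0<length-filterᵇ : ∀ {f : A → Bool} {x xs} → x ∈ xs → T (f x) → 0 ℕ.< length (filterᵇ f xs)
  ∈⇒0<length-filterᵇ {f} {x} (here refl) fx with f x
  ... | true = s≤s z≤n
  ∈⇒0<length-filterᵇ {f} {xs = y ∷ _} (there x∈) fx with f y
  ... | true  = s≤s z≤n
  ... | false = ∈⇒0<length-filterᵇ x∈ fx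

-- Linear algebra over a finite field

module LinearAlgebra {q : ℕ} (𝔽 : FiniteField q) where

  open FiniteField 𝔽
  open FurstenbergSets 𝔽
  private module F = IsCommutativeRing isCommutativeRing

  ring : CommutativeRing 0ℓ 0ℓ
  ring = record { isCommutativeRing = isCommutativeRing }

  open Algebra.Properties.Ring (CommutativeRing.ring ring)
    using (-1*x≈-x; -‿distribʳ-*; -0#≈0#; -‿involutive)

  -- The additive group of 𝔽^ n.
  vectorGroup : ℕ → AbelianGroup 0ℓ 0ℓ
  vectorGroup n = record
    { Carrier = 𝔽^ n ; _≈_ = _≡_ ; _∙_ = _+ᴹ_ ; ε = 0ᴹ ; _⁻¹ = -ᴹ_
    ; isAbelianGroup = record
      { isGroup = record
        { isMonoid = record
          { isSemigroup = record
            { isMagma = record { isEquivalence = isEquivalence ; ∙-cong = cong₂ _+ᴹ_ }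
            ; assoc = Vec.zipWith-assoc F.+-assoc }
          ; identity = Vec.zipWith-identityˡ F.+-identityˡ , Vec.zipWith-identityʳ F.+-identityʳ }
        ; inverse = Vec.zipWith-inverseˡ F.-‿inverseˡ , Vec.zipWith-inverseʳ F.-‿inverseʳ
        ; ⁻¹-cong = cong -ᴹ_ }
      ; comm = Vec.zipWith-comm F.+-comm } }

  -- Laws of vector addition.
  module V {n : ℕ} where
    open AbelianGroup (vectorGroup n) public
      using (comm; identityˡ; identityʳ; inverseˡ; inverseʳ; commutativeSemigroup)
    open Algebra.Properties.AbelianGroup (vectorGroup n) public using (inverseˡ-unique; //-rightDividesˡ)
    open Algebra.Properties.CommutativeSemigroup commutativeSemigroup public using (interchange)

  *ₗ-distribˡ : ∀ {n} a (x y : 𝔽^ n) → a *ₗ (x +ᴹ y) ≡ (a *ₗ x) +ᴹ (a *ₗ y)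
  *ₗ-distribˡ a []      []      = refl
  *ₗ-distribˡ a (b ∷ x) (c ∷ y) = cong₂ _∷_ (F.distribˡ a b c) (*ₗ-distribˡ a x y)

  *ₗ-distribʳ : ∀ {n} a b (x : 𝔽^ n) → (a ⊕ b) *ₗ x ≡ (a *ₗ x) +ᴹ (b *ₗ x)
  *ₗ-distribʳ a b []      = refl
  *ₗ-distribʳ a b (c ∷ x) = cong₂ _∷_ (F.distribʳ c a b) (*ₗ-distribʳ a b x)

  *ₗ-assoc : ∀ {n} a b (x : 𝔽^ n) → (a ⊗ b) *ₗ x ≡ a *ₗ (b *ₗ x)
  *ₗ-assoc a b []      = refl
  *ₗ-assoc a b (c ∷ x) = cong₂ _∷_ (F.*-assoc a b c) (*ₗ-assoc a b x)

  0*ₗ : ∀ {n} (x : 𝔽^ n) → 0# *ₗ x ≡ 0ᴹ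
  0*ₗ []      = refl
  0*ₗ (a ∷ x) = cong₂ _∷_ (F.zeroˡ a) (0*ₗ x)

  *ₗ0 : ∀ {n} a → a *ₗ 0ᴹ {n} ≡ 0ᴹ
  *ₗ0 {zero}  a = refl
  *ₗ0 {suc n} a = cong₂ _∷_ (F.zeroʳ a) (*ₗ0 a)

  -1*ₗ : ∀ {n} (x : 𝔽^ n) → neg 1# *ₗ x ≡ -ᴹ x
  -1*ₗ = Vec.map-cong -1*x≈-x

  -- Compatibility with zero, negation and scalars on the right comes from the other two laws.
  linear : ∀ {n N} (f : 𝔽^ n → 𝔽^ N) → (∀ x y → f (x +ᴹ y) ≡ f x +ᴹ f y) →
           (∀ a x → f (a *ₗ x) ≡ a *ₗ f x) → IsLinear f
  linear f f-+ f-* = record { isBimoduleHomomorphism = record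
    { +ᴹ-isGroupHomomorphism = record
      { isMonoidHomomorphism = record
        { isMagmaHomomorphism = record { isRelHomomorphism = record { cong = cong f } ; homo = f-+ }
        ; ε-homo = trans (cong f (sym (0*ₗ 0ᴹ))) (trans (f-* 0# 0ᴹ) (0*ₗ (f 0ᴹ))) }
      ; ⁻¹-homo = λ x → trans (cong f (sym (-1*ₗ x))) (trans (f-* (neg 1#) x) (-1*ₗ (f x))) }
    ; *ₗ-homo = f-*
    ; *ᵣ-homo = λ a x → trans (cong f (*ᵣ≡*ₗ a x)) (trans (f-* a x) (sym (*ᵣ≡*ₗ a (f x)))) } }
    where
    *ᵣ≡*ₗ : ∀ {n} a (x : 𝔽^ n) → Vec.map (_⊗ a) x ≡ a *ₗ x
    *ᵣ≡*ₗ a = Vec.map-cong λ b → F.*-comm b a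

  module Linearity {n N} {f : 𝔽^ n → 𝔽^ N} (f-linear : IsLinear f) where
    open Algebra.Module.Morphism.Structures.ModuleMorphisms.IsModuleHomomorphism f-linear public
      using (+ᴹ-homo; -ᴹ-homo; *ₗ-homo)

  id-linear : ∀ {n} → IsLinear {n} id
  id-linear = linear id (λ _ _ → refl) (λ _ _ → refl)

  ∘-linear : ∀ {n N M} {f : 𝔽^ n → 𝔽^ N} {g : 𝔽^ N → 𝔽^ M} → IsLinear g → IsLinear f → IsLinear (g ∘ f)
  ∘-linear {f = f} {g} g-lin f-lin = linear (g ∘ f)
    (λ x y → trans (cong g (Linearity.+ᴹ-homo f-lin x y)) (Linearity.+ᴹ-homo g-lin (f x) (f y)))
    (λ a x → trans (cong g (Linearity.*ₗ-homo f-lin a x)) (Linearity.*ₗ-homo g-lin a (f x)))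

  -- Surjectivity, without the quantifier over equal arguments in Surjective.
  Onto : ∀ {n N} → (𝔽^ n → 𝔽^ N) → Set
  Onto f = ∀ y → ∃ λ x → f x ≡ y

  -- For every nonzero vector u some onto linear map to dimension one less has its kernel in the
  -- line of u. If the first coordinate of u is nonzero, subtract the multiple of u that clears
  -- the first coordinate and drop that coordinate; otherwise keep the first coordinate and
  -- recurse on the others.
  quotient-by-vector : ∀ {N} (u : 𝔽^ (suc N)) → u ≢ 0ᴹ → ∃ λ (ψ : 𝔽^ (suc N) → 𝔽^ N) →
    IsLinear ψ × Onto ψ × (∀ z → ψ z ≡ 0ᴹ → ∃ λ a → z ≡ a *ₗ u)
  quotient-by-vector {N} (c ∷ u) cu≢0 with c ≟ 0#
  ... | no c≢0 = ψ , linear ψ ψ-+ ψ-* , (λ y → 0# ∷ y , ψ-onto y) , ψ-kernel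
    where
    c⁻¹ r : Carrier
    c⁻¹ = proj₁ (inverse c c≢0)
    r = neg c⁻¹
    ψ : 𝔽^ (suc N) → 𝔽^ N
    ψ (b ∷ z) = z +ᴹ ((b ⊗ r) *ₗ u)
    ψ-+ : ∀ x y → ψ (x +ᴹ y) ≡ ψ x +ᴹ ψ y
    ψ-+ (a ∷ x) (b ∷ y) = begin
      (x +ᴹ y) +ᴹ (((a ⊕ b) ⊗ r) *ₗ u)
        ≡⟨ cong ((x +ᴹ y) +ᴹ_) (trans (cong (_*ₗ u) (F.distribʳ r a b)) (*ₗ-distribʳ (a ⊗ r) (b ⊗ r) u)) ⟩
      (x +ᴹ y) +ᴹ (((a ⊗ r) *ₗ u) +ᴹ ((b ⊗ r) *ₗ u))
        ≡⟨ V.interchange x y _ _ ⟩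
      (x +ᴹ ((a ⊗ r) *ₗ u)) +ᴹ (y +ᴹ ((b ⊗ r) *ₗ u)) ∎
      where open ≡-Reasoning
    ψ-* : ∀ a x → ψ (a *ₗ x) ≡ a *ₗ ψ x
    ψ-* a (b ∷ x) = trans
      (cong ((a *ₗ x) +ᴹ_) (trans (cong (_*ₗ u) (F.*-assoc a b r)) (*ₗ-assoc a (b ⊗ r) u)))
      (sym (*ₗ-distribˡ a x ((b ⊗ r) *ₗ u)))
    ψ-onto : ∀ y → ψ (0# ∷ y) ≡ y
    ψ-onto y = trans (cong (λ s → y +ᴹ (s *ₗ u)) (F.zeroˡ r)) (trans (cong (y +ᴹ_) (0*ₗ u)) (V.identityʳ y))
    ψ-kernel : ∀ z → ψ z ≡ 0ᴹ → ∃ λ a → z ≡ a *ₗ (c ∷ u)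
    ψ-kernel (b ∷ z) ψz≡0 = b ⊗ c⁻¹ , cong₂ _∷_ head tail
      where
      open ≡-Reasoning
      head : b ≡ (b ⊗ c⁻¹) ⊗ c
      head = sym (trans (F.*-assoc b c⁻¹ c)
        (trans (cong (b ⊗_) (trans (F.*-comm c⁻¹ c) (proj₂ (inverse c c≢0)))) (F.*-identityʳ b)))
      tail : z ≡ (b ⊗ c⁻¹) *ₗ u
      tail = begin
        z                              ≡⟨ V.inverseˡ-unique z ((b ⊗ r) *ₗ u) ψz≡0 ⟩
        -ᴹ ((b ⊗ r) *ₗ u)              ≡⟨ sym (-1*ₗ ((b ⊗ r) *ₗ u)) ⟩
        neg 1# *ₗ ((b ⊗ r) *ₗ u)       ≡⟨ sym (*ₗ-assoc (neg 1#) (b ⊗ r) u) ⟩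
        (neg 1# ⊗ (b ⊗ r)) *ₗ u        ≡⟨ cong (_*ₗ u) (trans (-1*x≈-x (b ⊗ r))
                                            (trans (-‿distribʳ-* b r) (cong (b ⊗_) (-‿involutive c⁻¹)))) ⟩
        (b ⊗ c⁻¹) *ₗ u                 ∎
  quotient-by-vector {zero} (c ∷ []) cu≢0 | yes c≡0 = ⊥-elim (cu≢0 (cong (_∷ []) c≡0))
  quotient-by-vector {suc N} (c ∷ u) cu≢0 | yes c≡0 = extended
    (quotient-by-vector u λ u≡0 → cu≢0 (cong₂ _∷_ c≡0 u≡0))
    where
    extended : (∃ λ (ψ : 𝔽^ (suc N) → 𝔽^ N) → IsLinear ψ × Onto ψ × (∀ z → ψ z ≡ 0ᴹ → ∃ λ a → z ≡ a *ₗ u)) →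
      ∃ λ (ψ : 𝔽^ (suc (suc N)) → 𝔽^ (suc N)) →
        IsLinear ψ × Onto ψ × (∀ z → ψ z ≡ 0ᴹ → ∃ λ a → z ≡ a *ₗ (c ∷ u))
    extended (ψ , ψ-lin , ψ-onto , ψ-kernel) = ψ′ ,
      linear ψ′ (λ { (a ∷ x) (b ∷ y) → cong ((a ⊕ b) ∷_) (Linearity.+ᴹ-homo ψ-lin x y) })
                (λ { a (b ∷ x) → cong ((a ⊗ b) ∷_) (Linearity.*ₗ-homo ψ-lin a x) }) ,
      (λ { (b ∷ y) → let x , ψx≡y = ψ-onto y in b ∷ x , cong (b ∷_) ψx≡y }) ,
      λ { (b ∷ z) ψz≡0 → let a , z≡au = ψ-kernel z (Vec.∷-injectiveʳ ψz≡0)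
                         in a , cong₂ _∷_ (trans (Vec.∷-injectiveˡ ψz≡0)
                                  (sym (trans (cong (a ⊗_) c≡0) (F.zeroʳ a)))) z≡au }
      where
      ψ′ : 𝔽^ (suc (suc N)) → 𝔽^ (suc N)
      ψ′ (b ∷ z) = b ∷ ψ z

  -- Linear independence of the family xs, as in IsBasis.
  Independent : ∀ {n k} → Vec (𝔽^ n) k → Set
  Independent xs = ∀ as → combination as xs ≡ 0ᴹ → as ≡ 0ᴹ

  -- x is a linear combination of xs.
  InSpan : ∀ {n k} → Vec (𝔽^ n) k → 𝔽^ n → Set
  InSpan xs x = ∃ λ as → combination as xs ≡ x

  Independent-tail : ∀ {n k} {x : 𝔽^ n} {xs : Vec (𝔽^ n) k} → Independent (x ∷ xs) → Independent xs
  Independent-tail {x = x} {xs} ind as comb≡0 = Vec.∷-injectiveʳ (ind (0# ∷ as)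
    (trans (cong₂ _+ᴹ_ (0*ₗ x) comb≡0) (V.identityˡ 0ᴹ)))

  Independent-head : ∀ {n k} {x : 𝔽^ n} {xs : Vec (𝔽^ n) k} → Independent (x ∷ xs) → ¬ InSpan xs x
  Independent-head {x = x} {xs} ind (as , comb≡x) = 0#≢1# (sym (begin
    1#              ≡⟨ sym (-‿involutive 1#) ⟩
    neg (neg 1#)    ≡⟨ cong neg (Vec.∷-injectiveˡ (ind (neg 1# ∷ as)
                         (trans (cong₂ _+ᴹ_ (-1*ₗ x) comb≡x) (V.inverseˡ x)))) ⟩
    neg 0#          ≡⟨ -0#≈0# ⟩
    0#              ∎))
    where open ≡-Reasoning

  -- For k independent vectors in 𝔽^ n there is an onto linear map whose kernel lies in their
  -- span. Its codomain has dimension d = n - k, obtained as a witness because the recursion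
  -- removes one coordinate per vector. The head x is not killed by the map for the tail, by
  -- independence, so its image can be divided out.
  quotient-by-span : ∀ {n k} (xs : Vec (𝔽^ n) k) → Independent xs →
    ∃ λ d → n ≡ k ℕ.+ d × ∃ λ (φ : 𝔽^ n → 𝔽^ d) → IsLinear φ × Onto φ × (∀ z → φ z ≡ 0ᴹ → InSpan xs z)
  quotient-by-span {n} [] _ = n , refl , id , id-linear , (λ y → y , refl) , λ z z≡0 → [] , sym z≡0
  quotient-by-span {n} {suc k} (x ∷ xs) ind with quotient-by-span xs (Independent-tail ind)
  ... | d , n≡k+d , φ , φ-lin , φ-onto , φ-kernel = step d n≡k+d φ φ-lin φ-onto φ-kernel
    where
    step : ∀ d → n ≡ k ℕ.+ d → (φ : 𝔽^ n → 𝔽^ d) → IsLinear φ → Onto φ → (∀ z → φ z ≡ 0ᴹ → InSpan xs z) →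
      ∃ λ d → n ≡ suc k ℕ.+ d × ∃ λ (φ : 𝔽^ n → 𝔽^ d) →
        IsLinear φ × Onto φ × (∀ z → φ z ≡ 0ᴹ → InSpan (x ∷ xs) z)
    step zero n≡ φ φ-lin φ-onto φ-kernel = ⊥-elim (Independent-head ind (φ-kernel x (only-0 (φ x))))
      where
      only-0 : ∀ (y : 𝔽^ 0) → y ≡ 0ᴹ
      only-0 [] = refl
    step (suc d) n≡ φ φ-lin φ-onto φ-kernel =
      let ψ , ψ-lin , ψ-onto , ψ-kernel = quotient-by-vector (φ x) (λ φx≡0 → Independent-head ind (φ-kernel x φx≡0))
      in d , trans n≡ (ℕ.+-suc k d) , ψ ∘ φ , ∘-linear ψ-lin φ-lin ,
         (λ y → let w , ψw≡y = ψ-onto y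
                    z , φz≡w = φ-onto w
                in z , trans (cong ψ φz≡w) ψw≡y) ,
         λ z ψφz≡0 →
           let a , φz≡aφx = ψ-kernel (φ z) ψφz≡0
               as , comb≡ = φ-kernel (z +ᴹ (-ᴹ (a *ₗ x))) (difference z a φz≡aφx)
           in a ∷ as , trans (cong ((a *ₗ x) +ᴹ_) comb≡) (trans (V.comm _ _) (V.//-rightDividesˡ (a *ₗ x) z))
      where
      difference : ∀ z a → φ z ≡ a *ₗ φ x → φ (z +ᴹ (-ᴹ (a *ₗ x))) ≡ 0ᴹ
      difference z a φz≡aφx = begin
        φ (z +ᴹ (-ᴹ (a *ₗ x)))        ≡⟨ Linearity.+ᴹ-homo φ-lin z (-ᴹ (a *ₗ x)) ⟩
        φ z +ᴹ φ (-ᴹ (a *ₗ x))        ≡⟨ cong₂ _+ᴹ_ φz≡aφx (trans (Linearity.-ᴹ-homo φ-lin (a *ₗ x))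
                                            (cong -ᴹ_ (Linearity.*ₗ-homo φ-lin a x))) ⟩
        (a *ₗ φ x) +ᴹ (-ᴹ (a *ₗ φ x)) ≡⟨ V.inverseʳ (a *ₗ φ x) ⟩
        0ᴹ                            ∎
        where open ≡-Reasoning

  -- The first k standard basis vectors.
  independent-family : ∀ {k n} → k ℕ.≤ n → ∃ λ (xs : Vec (𝔽^ n) k) → Independent xs
  independent-family z≤n       = [] , λ { [] _ → refl }
  independent-family {suc k} {suc n} (s≤s k≤n) =
    let xs , ind = independent-family k≤n
    in (1# ∷ 0ᴹ) ∷ Vec.map (0# ∷_) xs , λ { (a ∷ as) comb≡0 →
      let comb≡ = trans (sym (combination-∷ a as xs)) comb≡0
      in cong₂ _∷_ (Vec.∷-injectiveˡ comb≡) (ind as (Vec.∷-injectiveʳ comb≡)) }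
    where
    combination-0∷ : ∀ {k n} as (xs : Vec (𝔽^ n) k) → combination as (Vec.map (0# ∷_) xs) ≡ 0# ∷ combination as xs
    combination-0∷ []       []       = refl
    combination-0∷ (a ∷ as) (x ∷ xs) = trans (cong ((a *ₗ (0# ∷ x)) +ᴹ_) (combination-0∷ as xs))
      (cong (_∷ ((a *ₗ x) +ᴹ combination as xs)) (trans (F.+-identityʳ (a ⊗ 0#)) (F.zeroʳ a)))
    combination-∷ : ∀ {k n} a as (xs : Vec (𝔽^ n) k) →
      combination (a ∷ as) ((1# ∷ 0ᴹ) ∷ Vec.map (0# ∷_) xs) ≡ a ∷ combination as xs
    combination-∷ a as xs = trans (cong ((a *ₗ (1# ∷ 0ᴹ)) +ᴹ_) (combination-0∷ as xs))
      (cong₂ _∷_ (trans (F.+-identityʳ (a ⊗ 1#)) (F.*-identityʳ a))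
                 (trans (cong (_+ᴹ combination as xs) (*ₗ0 a)) (V.identityˡ (combination as xs))))

  -- Spans as decidable subsets

  search-𝔽 : Searchable Carrier
  search-𝔽 {P} P? = map′ (λ (i , p) → Inverse.to enumeration i , p)
    (λ (a , p) → Inverse.from enumeration a , subst P (sym (Inverse.strictlyInverseˡ enumeration a)) p)
    (Fin.any? λ i → P? (Inverse.to enumeration i))

  search-vectors : ∀ n → Searchable (𝔽^ n)
  search-vectors = search-Vec search-𝔽

  inSpan? : ∀ {n k} (xs : Vec (𝔽^ n) k) → Decidable (InSpan xs)
  inSpan? {k = k} xs x = search-vectors k λ as → Vec.≡-dec _≟_ (combination as xs) x

  independent? : ∀ {n k} → Decidable (Independent {n} {k})
  independent? {k = k} xs = search-all (search-vectors k) λ as →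
    Vec.≡-dec _≟_ (combination as xs) 0ᴹ →-dec Vec.≡-dec _≟_ as 0ᴹ

  -- The span of xs as a decidable subset. That it is a subspace is not needed.
  span : ∀ {n k} → Vec (𝔽^ n) k → Subset n
  span xs x = does (inSpan? xs x)

  span⇒ : ∀ {n k} (xs : Vec (𝔽^ n) k) {x} → x ∈ˢ span xs → InSpan xs x
  span⇒ xs {x} = does⇒ (inSpan? xs x)

  ⇒span : ∀ {n k} (xs : Vec (𝔽^ n) k) {x} → InSpan xs x → x ∈ˢ span xs
  ⇒span xs {x} = ⇒does (inSpan? xs x)

  combination-closed : ∀ {n k} {W : Subset n} → IsSubspace W → (xs : Vec (𝔽^ n) k) →
    (∀ i → Vec.lookup xs i ∈ˢ W) → ∀ as → combination as xs ∈ˢ W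
  combination-closed W-sub []       xs⊆W []       = IsSubspace.0-closed W-sub
  combination-closed W-sub (x ∷ xs) xs⊆W (a ∷ as) = IsSubspace.+-closed W-sub
    (IsSubspace.*-closed W-sub a (xs⊆W zero)) (combination-closed W-sub xs (xs⊆W ∘ suc) as)

  -- Inclusion of subsets.
  infix 4 _⊆_
  _⊆_ : ∀ {n} → Subset n → Subset n → Set
  S ⊆ T = ∀ x → x ∈ˢ S → x ∈ˢ T

  ∣∣-mono : ∀ {n} (S T : Subset n) → S ⊆ T → ∣ S ∣ ℕ.≤ ∣ T ∣
  ∣∣-mono {n} S T S⊆T = length-filterᵇ-mono {f = S} {T} (S⊆T _) (vectors n)

  ∈-∩ : ∀ {n} (S T : Subset n) x → x ∈ˢ S → x ∈ˢ T → x ∈ˢ S ∩ T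
  ∈-∩ S T x x∈S x∈T with S x
  ... | true = x∈T

  ∩-⊆ˡ : ∀ {n} (S T : Subset n) → S ∩ T ⊆ S
  ∩-⊆ˡ S T x p with S x
  ... | true = _

  ∩-monoʳ : ∀ {n} (S T T′ : Subset n) → T ⊆ T′ → S ∩ T ⊆ S ∩ T′
  ∩-monoʳ S T T′ T⊆T′ x with S x
  ... | true  = T⊆T′ x
  ... | false = id

  -- The number of points of S that φ maps to w.
  fibreSize : ∀ {n d} → Subset n → (𝔽^ n → 𝔽^ d) → 𝔽^ d → ℕ
  fibreSize S φ w = length (filterᵇ (λ x → does (Vec.≡-dec _≟_ (φ x) w)) (members S))

  -- Where the Furstenberg property stops

  module _ {n} (k : ℕ) (S : Subset n) where

    -- Some translate of the span of xs meets S in at least m points.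
    RichTranslate : ℕ → Vec (𝔽^ n) k → Set
    RichTranslate m xs = ∃ λ v → m ℕ.≤ ∣ S ∩ translate v (span xs) ∣

    -- Rich m says that every k-dimensional span has a translate meeting S in at least m points,
    -- and Poor m that some k-dimensional span has none.
    Rich Poor : ℕ → Set
    Rich m = ∀ xs → Independent xs → RichTranslate m xs
    Poor m = ∃ λ xs → Independent xs × ¬ RichTranslate m xs

    rich-or-poor : ∀ m → Rich m ⊎ Poor m
    rich-or-poor m with all-or-counterexample (search-Vec (search-vectors n) k)
                          {λ xs → Independent xs → RichTranslate m xs} (λ xs → independent? xs →-dec search-vectors n λ v → m ℕ.≤? ∣ S ∩ translate v (span xs) ∣)
    ... | inj₁ rich = inj₁ rich
    ... | inj₂ (xs , ¬rich) = inj₂ (xs ,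
            decidable-stable (independent? xs) (λ ¬ind → ¬rich λ ind → ⊥-elim (¬ind ind)) ,
            λ R → ¬rich λ _ → R)

    rich⇒furstenberg : ∀ {m} → Rich m → IsFurstenberg k m S
    rich⇒furstenberg rich W W-sub (ys , ys-basis) =
      let v , m≤ = rich ys (IsBasis.independent ys-basis)
      in v , ℕ.≤-trans m≤ (∣∣-mono (S ∩ translate v (span ys)) (S ∩ translate v W)
           (∩-monoʳ S (translate v (span ys)) (translate v W) λ x p → span⊆W (span⇒ ys p)))
      where
      span⊆W : ∀ {x} → InSpan ys x → x ∈ˢ W
      span⊆W (as , refl) = combination-closed W-sub ys (IsBasis.contained ys-basis) as

    rich-1 : 0 ℕ.< ∣ S ∣ → Rich 1
    rich-1 0<S xs _ =
      let x , x∈S = filterᵇ-nonempty (vectors n) 0<S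
      in x , ∈⇒0<length-filterᵇ (∈-vectors x) (∈-∩ S (translate x (span xs)) x x∈S (⇒span xs
               (subst (InSpan xs) (sym (V.inverseʳ x)) (Vec.replicate k 0# , combination-0 xs))))
      where
      combination-0 : ∀ {k} (xs : Vec (𝔽^ n) k) → combination (Vec.replicate k 0#) xs ≡ 0ᴹ
      combination-0 []       = refl
      combination-0 (x ∷ xs) = trans (cong₂ _+ᴹ_ (0*ₗ x) (combination-0 xs)) (V.identityˡ 0ᴹ)

    ¬rich : k ℕ.≤ n → ¬ Rich (suc ∣ S ∣)
    ¬rich k≤n rich =
      let xs , ind = independent-family k≤n
          v , S<   = rich xs ind
      in ℕ.<-irrefl refl (ℕ.<-≤-trans S< (∣∣-mono (S ∩ translate v (span xs)) S (∩-⊆ˡ S (translate v (span xs)))))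

    fibreSize≤translate : ∀ {d} {φ : 𝔽^ n → 𝔽^ d} → IsLinear φ → (xs : Vec (𝔽^ n) k) →
      (∀ z → φ z ≡ 0ᴹ → InSpan xs z) → ∀ v → fibreSize S φ (φ v) ℕ.≤ ∣ S ∩ translate v (span xs) ∣
    fibreSize≤translate {φ = φ} φ-lin xs kernel v =
      subst (ℕ._≤ ∣ S ∩ translate v (span xs) ∣) (cong length (sym (filterᵇ-∘ fibre-of S (vectors n))))
        (∣∣-mono (S ∩ fibre-of) (S ∩ translate v (span xs)) (∩-monoʳ S fibre-of (translate v (span xs)) λ x p →
          ⇒span xs (kernel (x +ᴹ (-ᴹ v)) (difference x (does⇒ (Vec.≡-dec _≟_ (φ x) (φ v)) p)))))
      where
      fibre-of : Subset n
      fibre-of x = does (Vec.≡-dec _≟_ (φ x) (φ v))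
      difference : ∀ x → φ x ≡ φ v → φ (x +ᴹ (-ᴹ v)) ≡ 0ᴹ
      difference x φx≡φv = trans (Linearity.+ᴹ-homo φ-lin x (-ᴹ v))
        (trans (cong₂ _+ᴹ_ φx≡φv (Linearity.-ᴹ-homo φ-lin v)) (V.inverseʳ (φ v)))

    -- For M take a rich number with a poor successor. Some independent xs then have no translate
    -- of their span with M + 1 points of S. If the kernel of φ lies in the span of xs, the fibre
    -- of φ over φ v lies in the translate of the span by v, hence contains at most M points of S.
    furstenberg-threshold : 0 ℕ.< ∣ S ∣ → k ℕ.≤ n →
      ∃ λ M → 1 ℕ.≤ M × IsFurstenberg k M S ×
      ∃ λ (φ : 𝔽^ n → 𝔽^ (n ℕ.∸ k)) → IsLinear φ × Onto φ × (∀ w → fibreSize S φ w ℕ.≤ M)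
    furstenberg-threshold 0<S k≤n =
      let M , 1≤M , rich , xs , ind , ¬R = last-success rich-or-poor ∣ S ∣ (rich-1 0<S)
            (subst (λ j → ¬ Rich j) (ℕ.+-comm 1 ∣ S ∣) (¬rich k≤n))
          d , n≡k+d , φ , φ-lin , φ-onto , kernel = quotient-by-span xs ind
      in M , 1≤M , rich⇒furstenberg rich ,
         subst (λ d → ∃ λ (φ : 𝔽^ n → 𝔽^ d) → IsLinear φ × Onto φ × (∀ w → fibreSize S φ w ℕ.≤ M))
           (sym (trans (cong (ℕ._∸ k) n≡k+d) (ℕ.m+n∸m≡n k d)))
           (φ , φ-lin , φ-onto , λ w →
              let v , φv≡w = φ-onto w
              in ℕ.s≤s⁻¹ (ℕ.≰⇒> λ M< → ¬R (v , ℕ.≤-trans M< (subst (λ w → fibreSize S φ w ℕ.≤ ∣ S ∩ translate v (span xs) ∣)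
                   φv≡w (fibreSize≤translate φ-lin xs kernel v)))))

  -- Probabilities of the image of a uniform distribution

  open RealEstimates

  -- The probability of w is the number of points of S over w, each of weight 1 / |S|.
  maxPr-image : ∀ {n d} (S : Subset n) .{{_ : NonZero ∣ S ∣}} (φ : 𝔽^ n → 𝔽^ d) M →
    (∀ w → fibreSize S φ w ℕ.≤ M) → maxPr (φ ⟨ uniform S ⟩) ≤ℝ fromℚ (fromℕ M ℚ.* (+ 1 / ∣ S ∣))
  maxPr-image {d = d} S φ M fibre≤M = maxℝ-least
    (fromℚ-mono (*-nonNeg (fromℕ-nonNeg M) (1/n-nonNeg ∣ S ∣)))
    (λ w → ≤ℝ-trans (Σℝ-indicator (λ x → does (Vec.≡-dec _≟_ (φ x) w)) (+ 1 / ∣ S ∣) (members S))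
      (fromℚ-mono (*-monoʳ (1/n-nonNeg ∣ S ∣) (fromℕ-mono (fibre≤M w)))))
    (vectors d)

open import Data.Nat using (_<_)

lemma16 : ∀ {q} → IsPrimePower q → (𝔽 : FiniteField q) →
    let open FurstenbergSets 𝔽 in
    ∀ k n → .{{_ : NonZero k}} → (k<n : k < n) →
    (C : ℝ) → (0<C : 0ℝ <ℝ C) → C ≤ℝ 1ℝ →
    StatementA n k C →
    StatementB n k (fromℚ (_/_ (+ k) n {{m<n⇒nonZero k<n}}) *ℝ logq (inv C 0<C) (inv-pos 0<C))
lemma16 {q} _ 𝔽 k n k<n C 0<C _ A δ _ _ S size =
  let M , 1≤M , furstenberg , φ , φ-linear , φ-onto , fibre≤M =
        furstenberg-threshold k S (ℕ.>-nonZero⁻¹ ∣ S ∣ {{S≢∅}}) (ℕ.<⇒≤ k<n)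
      instance
        M≢0 : NonZero M
        M≢0 = ℕ.>-nonZero 1≤M
  in φ , φ-linear , (λ y → let x , φx≡y = φ-onto y in x , λ { refl → φx≡y }) ,
     entropy-bound q n k (n ℕ.∸ k) (sym (ℕ.m+[n∸m]≡n (ℕ.<⇒≤ k<n))) ∣ S ∣ M 0<C (maxPr-pos _)
       (A M S furstenberg) (proj₂ size) (maxPr-image S φ M fibre≤M)
  where
  open RealEstimates
  open FurstenbergSets 𝔽
  open LinearAlgebra 𝔽
  instance
    n≢0 : NonZero n
    n≢0 = m<n⇒nonZero k<n
    S≢∅ : NonZero ∣ S ∣
    S≢∅ = power-≉0 ∣ S ∣ q (δ *ℝ fromℕℝ n) size
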